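{- Let $G=(V,E)$ be a simple graph with uniformly bounded vertex degrees, let $\mathrm{Deg}_{\max}$ be its largest degree, and let $R\ge1$ be an integer. Suppose $K_R(x,y)\ge0$ for all $x,y\in V$ with $d(x,y)\le R$. Let $\lambda\in\mathbb{R}$ be an eigenvalue of $-\Delta$ with bounded eigenfunction $f:V\to\mathbb{R}$, i.e. $f\in\ell^\infty(V)$, $f\ne0$ and $-\Delta f=\lambda f$. Then, pointwise on $V$, $$|\nabla_Rf|^2\le 2eR\,\mathrm{Deg}_{\max}^{R-1}\,\lambda\,\|f\|_\infty^2 .$$
   Context: $d(x,y)$ is the combinatorial (path) distance. $\Delta f(x)=\sum_{y\sim x}(f(y)-f(x))$. $|\nabla_R f|(x)=\max_{d(x,y)\le R}|f(y)-f(x)|$. Gradient-Ollivier curvature: $$K_R(x,y)=\inf\big\{\Delta|\nabla_R f|(x)-(\Delta f(y)-\Delta f(x))\,\mathrm{sgn}(f(y)-f(x))\big\},$$ over all $f:V\to\mathbb{R}$ with $|\nabla_Rf|(x)=1$ and $|f(y)-f(x)|=|\nabla_R f|(x)$ (with $\inf\emptyset=+\infty$). Here $e$ is Euler's number. -}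

module Defs where

open import Algebra.Bundles using (CommutativeRing)
open import Axiom.ExcludedMiddle using (ExcludedMiddle)
open import Data.List.Base using (List; []; _∷_; foldr; map; concatMap; length)
open import Data.List.Membership.Propositional using (_∈_; find; lose)
open import Data.List.Membership.Propositional.Properties using (∈-concatMap⁺; ∈-concatMap⁻)
open import Data.List.Relation.Unary.Any using (here; there)
open import Data.List.Relation.Unary.Unique.Propositional using (Unique)
open import Data.Nat.Base as ℕ using (ℕ; zero; suc)
import Data.Nat.Properties as ℕ
open import Data.Nat.Induction using (<-rec)
open import Data.Product.Base using (Σ; ∃; _×_; _,_; proj₁; proj₂)
open import Data.Sum.Base using (_⊎_; inj₁; inj₂)
open import Data.Empty using (⊥-elim)
open import Function.Bundles using (_⇔_; mk⇔; Equivalence)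
open import Level using (0ℓ)
open import Relation.Binary.Bundles using (TotalOrder)
open import Relation.Binary.Core using (Rel)
open import Relation.Binary.PropositionalEquality.Core using (_≡_; refl)
open import Relation.Binary.Structures using (IsTotalOrder)
open import Relation.Nullary using (¬_; yes; no)
open import Relation.Nullary.Construct.Add.Extrema using (_±; ⊥±; ⊤±; [_])
import Algebra.Construct.NaturalChoice.Max as Max
import Algebra.Construct.NaturalChoice.MaxOp as MaxOp
import Algebra.Properties.Ring as RingProperties
import Relation.Binary.Construct.Add.Extrema.NonStrict as Extrema

module Bounds {A : Set} (_≤_ : Rel A 0ℓ) where

  UpperBound : (A → Set) → A → Set
  UpperBound S b = ∀ s → S s → s ≤ b

  LowerBound : (A → Set) → A → Set
  LowerBound S b = ∀ s → S s → b ≤ s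

  IsSupremum : (A → Set) → A → Set
  IsSupremum S b = UpperBound S b × LowerBound (UpperBound S) b

-- The axioms of the real numbers.  In the presence of excluded middle (assumed
-- in the module Analysis below) they determine ℝ up to unique isomorphism.
record CompleteOrderedField : Set₁ where
  infix 4 _≤_
  field
    commutativeRing : CommutativeRing 0ℓ 0ℓ

  open CommutativeRing commutativeRing public

  field
    _≤_          : Rel Carrier 0ℓ
    isTotalOrder : IsTotalOrder _≈_ _≤_
    0≉1          : ¬ 0# ≈ 1#
    inverse      : ∀ x → ¬ x ≈ 0# → ∃ λ y → x * y ≈ 1#
    +-monoˡ-≤    : ∀ z {x y} → x ≤ y → x + z ≤ y + z
    *-nonNeg     : ∀ {x y} → 0# ≤ x → 0# ≤ y → 0# ≤ x * y

  open Bounds _≤_ public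

  field
    complete : ∀ S → ∃ S → ∃ (UpperBound S) → ∃ (IsSupremum S)

-- Simple, locally finite graphs.
record Graph : Set₁ where
  infix 4 _~_
  field
    V            : Set
    _~_          : V → V → Set
    ~-sym        : ∀ {x y} → x ~ y → y ~ x
    ~-irrefl     : ∀ {x} → ¬ x ~ x
    nbrs         : V → List V
    nbrs-unique  : ∀ x → Unique (nbrs x)
    ∈-nbrs       : ∀ {x y} → y ∈ nbrs x ⇔ x ~ y

  deg : V → ℕ
  deg x = length (nbrs x)

  -- In particular the degrees are then uniformly bounded.
  IsLargestDegree : ℕ → Set
  IsLargestDegree D = (∀ x → deg x ℕ.≤ D) × (∃ λ x → deg x ≡ D)

  infixr 5 _∷_
  data Walk : V → V → ℕ → Set where
    []  : ∀ {x} → Walk x x 0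
    _∷_ : ∀ {x y z n} → x ~ y → Walk y z n → Walk x z (suc n)

  -- d(x,y) = n.  There is no such n when x and y lie in different components,
  -- i.e. when d(x,y) = ∞.
  IsDistance : V → V → ℕ → Set
  IsDistance x y n = Walk x y n × (∀ m → Walk x y m → n ℕ.≤ m)

  infix 4 d⟨_,_⟩≤_
  d⟨_,_⟩≤_ : V → V → ℕ → Set
  d⟨ x , y ⟩≤ R = ∃ λ n → IsDistance x y n × n ℕ.≤ R

  -- Lists the vertices y with d(x,y) ≤ R (see ∈-ball), possibly repeatedly.
  ball : ℕ → V → List V
  ball zero    x = x ∷ []
  ball (suc R) x = x ∷ concatMap (ball R) (nbrs x)

  ball⇒walk : ∀ R {x y} → y ∈ ball R x → ∃ λ n → Walk x y n × n ℕ.≤ R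
  ball⇒walk zero    (here refl) = 0 , [] , ℕ.z≤n
  ball⇒walk (suc R) (here refl) = 0 , [] , ℕ.z≤n
  ball⇒walk (suc R) {x} (there y∈)
    with z , z∈ , y∈ball ← find (∈-concatMap⁻ (ball R) {xs = nbrs x} y∈)
    with n , w , n≤R ← ball⇒walk R y∈ball
    = suc n , Equivalence.to ∈-nbrs z∈ ∷ w , ℕ.s≤s n≤R

  walk⇒ball : ∀ R {x y n} → Walk x y n → n ℕ.≤ R → y ∈ ball R x
  walk⇒ball zero    []      _           = here refl
  walk⇒ball (suc R) []      _           = here refl
  walk⇒ball (suc R) (e ∷ w) (ℕ.s≤s n≤R) =
    there (∈-concatMap⁺ (ball R) (lose (Equivalence.from ∈-nbrs e) (walk⇒ball R w n≤R)))

  module _ (em : ExcludedMiddle 0ℓ) where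

    walk⇒d≤ : ∀ {x y} n → Walk x y n → d⟨ x , y ⟩≤ n
    walk⇒d≤ {x} {y} = <-rec (λ n → Walk x y n → d⟨ x , y ⟩≤ n) shorten
      where
      shorten : ∀ n → (∀ {m} → m ℕ.< n → Walk x y m → d⟨ x , y ⟩≤ m) →
                Walk x y n → d⟨ x , y ⟩≤ n
      shorten n rec w with em {∃ λ m → m ℕ.< n × Walk x y m}
      ... | no  none = n , (w , λ m v → ℕ.≮⇒≥ (λ m<n → none (m , m<n , v))) , ℕ.≤-refl
      ... | yes (m , m<n , v) with k , isD , k≤m ← rec m<n v =
        k , isD , ℕ.≤-trans k≤m (ℕ.<⇒≤ m<n)

    ∈-ball : ∀ R {x y} → y ∈ ball R x ⇔ d⟨ x , y ⟩≤ R
    ∈-ball R {x} {y} = mk⇔ to from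
      where
      to : y ∈ ball R x → d⟨ x , y ⟩≤ R
      to y∈ with n , w , n≤R ← ball⇒walk R y∈
            with k , isD , k≤n ← walk⇒d≤ n w = k , isD , ℕ.≤-trans k≤n n≤R
      from : d⟨ x , y ⟩≤ R → y ∈ ball R x
      from (_ , (w , _) , n≤R) = walk⇒ball R w n≤R

module Analysis (em : ExcludedMiddle 0ℓ) (ℛ : CompleteOrderedField) where

  open CompleteOrderedField ℛ renaming (Carrier to ℝ) public
  open IsTotalOrder isTotalOrder public
    using (total; antisym; ≤-resp-≈)
    renaming (reflexive to ≤-reflexive; refl to ≤-refl; trans to ≤-trans)
  open RingProperties ring using (-‿distribʳ-*; -‿involutive)

  totalOrder : TotalOrder 0ℓ 0ℓ 0ℓ
  totalOrder = record { isTotalOrder = isTotalOrder }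

  open Max totalOrder using (_⊔_; maxOperator) public
  open MaxOp maxOperator using (x≤x⊔y; x≤y⊔x)

  open import Algebra.Properties.Semiring.Exp semiring using (_^_) public
  open import Algebra.Properties.Monoid.Mult +-monoid using () renaming (_×_ to _·_)

  fromℕ : ℕ → ℝ
  fromℕ n = n · 1#

  ∣_∣ : ℝ → ℝ
  ∣ r ∣ = r ⊔ (- r)

  sgn : ℝ → ℝ
  sgn r with em {r ≈ 0#} | total 0# r
  ... | yes _ | _      = 0#
  ... | no  _ | inj₁ _ = 1#
  ... | no  _ | inj₂ _ = - 1#

  open Extrema _≤_ using (_≤±_; ⊥±≤_; _≤⊤±) public
  open Extrema _≤_ using () renaming ([_] to [_]≤)

  IsInfimum± : (ℝ → Set) → ℝ ± → Set
  IsInfimum± S k =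
    (∀ s → S s → k ≤± [ s ]) × (∀ l → (∀ s → S s → l ≤± [ s ]) → l ≤± k)

  infimum : ∀ S → ∃ (IsInfimum± S)
  infimum S with em {∃ S}
  ... | no  empty = ⊤± , (λ s s∈S → ⊥-elim (empty (s , s∈S))) , (λ l _ → l ≤⊤±)
  ... | yes (s₀ , s₀∈S) with em {∃ (LowerBound S)}
  ...   | no  unbounded = ⊥± , (λ s _ → ⊥±≤ [ s ]) , greatest
    where
    greatest : ∀ l → (∀ s → S s → l ≤± [ s ]) → l ≤± ⊥±
    greatest ⊥±    _  = ⊥±≤ ⊥±
    greatest [ b ] lb = ⊥-elim (unbounded (b , λ s s∈S → unlift (lb s s∈S)))
      where
      unlift : ∀ {s} → [ b ] ≤± [ s ] → b ≤ s
      unlift [ p ]≤ = p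
    greatest ⊤±    lb with () ← lb s₀ s₀∈S
  ...   | yes bounded
    with m , ub , least ← complete (LowerBound S) bounded (s₀ , λ b lb → lb s₀ s₀∈S)
    = [ m ] , (λ s s∈S → [ least s (λ b lb → lb s s∈S) ]≤) , greatest
    where
    greatest : ∀ l → (∀ s → S s → l ≤± [ s ]) → l ≤± [ m ]
    greatest ⊥±    _  = ⊥±≤ [ m ]
    greatest [ b ] lb = [ ub b (λ s s∈S → unlift (lb s s∈S)) ]≤
      where
      unlift : ∀ {s} → [ b ] ≤± [ s ] → b ≤ s
      unlift [ p ]≤ = p
    greatest ⊤±    lb with () ← lb s₀ s₀∈S

  inf : (ℝ → Set) → ℝ ±
  inf S = proj₁ (infimum S)

  private
    neg-nonNeg : ∀ {x} → x ≤ 0# → 0# ≤ - x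
    neg-nonNeg {x} x≤0 = proj₁ ≤-resp-≈ (+-identityˡ (- x))
      (≤-trans (≤-reflexive (sym (-‿inverseʳ x))) (+-monoˡ-≤ (- x) x≤0))

    +-monoʳ-≤ : ∀ z {x y} → x ≤ y → z + x ≤ z + y
    +-monoʳ-≤ z {x} {y} x≤y = ≤-trans (≤-reflexive (+-comm z x))
      (≤-trans (+-monoˡ-≤ z x≤y) (≤-reflexive (+-comm y z)))

    ≤-addʳ : ∀ x {y} → 0# ≤ y → x ≤ x + y
    ≤-addʳ x 0≤y = ≤-trans (≤-reflexive (sym (+-identityʳ x))) (+-monoʳ-≤ x 0≤y)

    0≤1 : 0# ≤ 1#
    0≤1 with total 0# 1#
    ... | inj₁ p = p
    ... | inj₂ p = ≤-trans (*-nonNeg (neg-nonNeg p) (neg-nonNeg p)) (≤-reflexive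
      (trans (sym (-‿distribʳ-* (- 1#) 1#)) (trans (-‿cong (*-identityʳ (- 1#))) (-‿involutive 1#))))

    0≤fromℕ : ∀ n → 0# ≤ fromℕ n
    0≤fromℕ zero    = ≤-refl
    0≤fromℕ (suc n) = ≤-trans 0≤1 (≤-addʳ 1# (0≤fromℕ n))

    fromℕ-suc≉0 : ∀ n → ¬ fromℕ (suc n) ≈ 0#
    fromℕ-suc≉0 n eq =
      0≉1 (antisym 0≤1 (≤-trans (≤-addʳ 1# (0≤fromℕ n)) (≤-reflexive eq)))

  -- 1/(n+1)
  1/suc : ℕ → ℝ
  1/suc n = proj₁ (inverse (fromℕ (suc n)) (fromℕ-suc≉0 n))

  *-1/suc : ∀ n → fromℕ (suc n) * 1/suc n ≈ 1#
  *-1/suc n = proj₂ (inverse (fromℕ (suc n)) (fromℕ-suc≉0 n))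

  -- 1/n!
  1/_! : ℕ → ℝ
  1/ zero  ! = 1#
  1/ suc n ! = 1/ n ! * 1/suc n

  -- ∑_{k<n} 1/k!
  expSum : ℕ → ℝ
  expSum zero    = 0#
  expSum (suc n) = expSum n + 1/ n !

  private
    0≤1/suc : ∀ n → 0# ≤ 1/suc n
    0≤1/suc n with total 0# (1/suc n)
    ... | inj₁ p = p
    ... | inj₂ p = ⊥-elim (0≉1 (antisym 0≤1 1≤0))
      where
      0≤-1 : 0# ≤ - 1#
      0≤-1 = ≤-trans (*-nonNeg (0≤fromℕ (suc n)) (neg-nonNeg p)) (≤-reflexive
        (trans (sym (-‿distribʳ-* _ _)) (-‿cong (*-1/suc n))))
      1≤0 : 1# ≤ 0#
      1≤0 = ≤-trans (≤-addʳ 1# 0≤-1) (≤-reflexive (-‿inverseʳ 1#))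

    0≤1/! : ∀ n → 0# ≤ 1/ n !
    0≤1/! zero    = 0≤1
    0≤1/! (suc n) = *-nonNeg (0≤1/! n) (0≤1/suc n)

    1/suc-double : ∀ n → 1/suc (suc n) + 1/suc (suc n) ≤ 1#
    1/suc-double n = ≤-trans
      (+-monoʳ-≤ i (≤-addʳ i (*-nonNeg (0≤fromℕ n) (0≤1/suc (suc n)))))
      (≤-reflexive (trans (sym expand) (*-1/suc (suc n))))
      where
      i = 1/suc (suc n)
      expand : fromℕ (suc (suc n)) * i ≈ i + (i + fromℕ n * i)
      expand = trans (distribʳ i 1# _)
        (+-cong (*-identityˡ i) (trans (distribʳ i 1# _) (+-congʳ (*-identityˡ i))))

    *-monoʳ-≤ : ∀ {z x y} → 0# ≤ z → x ≤ y → z * x ≤ z * y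
    *-monoʳ-≤ {z} {x} {y} 0≤z x≤y = ≤-trans (≤-addʳ (z * x) (*-nonNeg 0≤z 0≤y-x))
      (≤-reflexive (trans (sym (distribˡ z x (y - x))) (*-congˡ x+[y-x]≈y)))
      where
      0≤y-x : 0# ≤ y - x
      0≤y-x = ≤-trans (≤-reflexive (sym (-‿inverseʳ x))) (+-monoˡ-≤ (- x) x≤y)
      x+[y-x]≈y : x + (y - x) ≈ y
      x+[y-x]≈y = trans (+-comm x (y - x)) (trans (+-assoc y (- x) x)
        (trans (+-congˡ (-‿inverseˡ x)) (+-identityʳ y)))

    expBound : ℝ
    expBound = expSum 2 + 1/ 1 !

    expSum-step : ∀ n → expSum (suc (suc n)) + 1/ suc n ! ≤ expBound
    expSum-step zero    = ≤-refl
    expSum-step (suc n) = ≤-trans (≤-reflexive (+-assoc _ t' t'))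
      (≤-trans (+-monoʳ-≤ (expSum (suc (suc n))) 2t'≤t) (expSum-step n))
      where
      t  = 1/ suc n !
      t' = 1/ suc (suc n) !
      2t'≤t : t' + t' ≤ t
      2t'≤t = ≤-trans (≤-reflexive (sym (distribˡ t _ _)))
        (≤-trans (*-monoʳ-≤ (0≤1/! (suc n)) (1/suc-double n)) (≤-reflexive (*-identityʳ t)))

    expSum-bounded : ∀ n → expSum n ≤ expBound
    expSum-bounded n = ≤-trans (≤-addʳ _ (0≤1/! n)) (≤-trans (≤-addʳ _ (0≤1/! (suc n)))
      (≤-trans (≤-addʳ _ (0≤1/! (suc n))) (expSum-step n)))

  ExpSums : ℝ → Set
  ExpSums r = ∃ λ n → r ≈ expSum n

  e-isSupremum : ∃ (IsSupremum ExpSums)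
  e-isSupremum = complete ExpSums (expSum 0 , 0 , CommutativeRing.refl commutativeRing)
    (expBound , λ { r (n , r≈) → ≤-trans (≤-reflexive r≈) (expSum-bounded n) })

  -- e = ∑_{k≥0} 1/k!, the sum of a series of nonnegative terms being the
  -- supremum of its partial sums.
  e : ℝ
  e = proj₁ e-isSupremum

  module OnGraph (G : Graph) where

    open Graph G public

    Bounded : (V → ℝ) → Set
    Bounded f = ∃ λ M → ∀ x → ∣ f x ∣ ≤ M

    -- The element 0 does not affect the supremum unless V is empty.
    AbsValues : (V → ℝ) → ℝ → Set
    AbsValues f r = r ≈ 0# ⊎ (∃ λ x → r ≈ ∣ f x ∣)

    supNorm-isSupremum : ∀ f → Bounded f → ∃ (IsSupremum (AbsValues f))
    supNorm-isSupremum f (M , ∣f∣≤M) =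
      complete (AbsValues f) (0# , inj₁ (CommutativeRing.refl commutativeRing)) (0# ⊔ M , upper)
      where
      upper : UpperBound (AbsValues f) (0# ⊔ M)
      upper r (inj₁ r≈0)       = ≤-trans (≤-reflexive r≈0) (x≤x⊔y 0# M)
      upper r (inj₂ (x , r≈)) =
        ≤-trans (≤-reflexive r≈) (≤-trans (∣f∣≤M x) (x≤y⊔x 0# M))

    ‖_‖∞ : ∃ Bounded → ℝ
    ‖ f , bounded ‖∞ = proj₁ (supNorm-isSupremum f bounded)

    Δ : (V → ℝ) → V → ℝ
    Δ f x = foldr _+_ 0# (map (λ y → f y - f x) (nbrs x))

    -- |∇_R f|(x).  Starting the maximum at 0 is harmless, as 0 = |f(x) - f(x)|.
    ∣∇_∣ : ℕ → (V → ℝ) → V → ℝ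
    ∣∇ R ∣ f x = foldr _⊔_ 0# (map (λ y → ∣ f y - f x ∣) (ball R x))

    CurvatureValues : ℕ → V → V → ℝ → Set
    CurvatureValues R x y r = Σ (V → ℝ) λ f →
      ∣∇ R ∣ f x ≈ 1# ×
      ∣ f y - f x ∣ ≈ ∣∇ R ∣ f x ×
      r ≈ Δ (∣∇ R ∣ f) x - (Δ f y - Δ f x) * sgn (f y - f x)

    K : ℕ → V → V → ℝ ±
    K R x y = inf (CurvatureValues R x y)

-- The curvature bound, applied to f/g(x) and a vertex y at which the maximum
-- g(x) = |∇_R f|(x) is attained, gives Δg + λg ≥ 0, hence ΔG + 2λG ≥ 0 for G = g².
-- On the other hand Δ(f²) + 2λf² = q with q(x) = ∑_{y~x} (f(y) - f(x))².  Let
-- D = Deg_max and Q = D + Δ, a positive operator commuting with Δ.  A shortest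
-- walk from x to a vertex y with d(x,y) ≤ R is nonbacktracking, so the sum of the
-- squared increments of f along it is at most (Q^{R-1} q)(x), and by Cauchy-Schwarz
-- G ≤ R Q^{R-1} q.  Thus U = R Q^{R-1}(f²), which is bounded by
-- B = R D^{R-1} ‖f‖∞², satisfies ΔU + 2λU ≥ G.  The heat flow then yields
-- e^{-2λt}(U + tG) ≤ B, and t = 1/(2λ) gives the claim.
module Submission where

open import Defs
open import Algebra.Bundles using (RawRing)
open import Axiom.ExcludedMiddle using (ExcludedMiddle)
open import Data.Nat.Base as ℕ using (ℕ; zero; suc)
import Data.Nat.Properties as ℕ
open import Data.List.Base using (List; []; _∷_; foldr; map; length)
open import Data.List.Membership.Propositional using (_∈_)
open import Data.List.Relation.Unary.Any using (here; there)
open import Data.Maybe.Base using (Maybe; just; nothing)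
open import Data.Product.Base using (∃; _×_; _,_; proj₁; proj₂)
open import Data.Sum.Base using (_⊎_; inj₁; inj₂)
open import Data.Unit.Base using (⊤; tt)
open import Function.Bundles using (Equivalence)
open import Data.Empty using (⊥-elim)
open import Level using (0ℓ)
open import Relation.Binary.PropositionalEquality as ≡ using (_≡_; _≢_)
open import Relation.Nullary using (¬_; yes; no)
open import Relation.Nullary.Construct.Add.Extrema using ([_])
open import Algebra.Solver.Ring.AlmostCommutativeRing
  using (fromCommutativeRing; _-Raw-AlmostCommutative⟶_)
open import Algebra.Construct.NaturalChoice.Base using (MaxOperator)
import Algebra.Construct.NaturalChoice.MaxOp as MaxOp
import Algebra.Properties.CommutativeSemiring.Exp as CommutativeSemiringExp
import Algebra.Solver.Ring as RingSolver
import Algebra.Properties.Ring as RingProperties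
import Algebra.Properties.AbelianGroup as AbelianGroupProperties
import Algebra.Properties.Semiring.Mult as SemiringMult
import Algebra.Properties.Semiring.Mult.TCOptimised as SemiringMult′
import Algebra.Properties.CommutativeSemigroup as CommutativeSemigroupProperties
import Relation.Binary.Construct.Add.Extrema.NonStrict as Extrema
import Relation.Binary.Reasoning.Setoid as SetoidReasoning

-- Ordered-field arithmetic, the Archimedean property and bounds for `e`.

module OrderedField (em : ExcludedMiddle 0ℓ) (ℛ : CompleteOrderedField) where

  open Analysis em ℛ hiding (zero)

  open MaxOperator maxOperator using (x≤y⇒x⊔y≈y; x≥y⇒x⊔y≈x)
  open MaxOp maxOperator public
    using (x≤y⊔x; ⊔-sel; ⊔-cong; mono-≤-distrib-⊔)
  open CommutativeSemiringExp commutativeSemiring public using (^-congˡ; ^-distrib-*)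

  module IntegerCoefficients where

    open SemiringMult semiring using (×-homo-+; ×1-homo-*)
    open SemiringMult′ semiring using (×ᵤ≈×) renaming (_×_ to _×′_)
    open RingProperties ring using (-0#≈0#; -‿distribˡ-*; -‿distribʳ-*; -‿involutive)
    open AbelianGroupProperties +-abelianGroup using (⁻¹-∙-comm)
    open CommutativeSemigroupProperties +-commutativeSemigroup using (interchange)
    open SetoidReasoning setoid

    -- The pair (a , b) stands for the integer a - b.
    ℤ′ : Set
    ℤ′ = ℕ × ℕ

    -- Cancelling keeps the representatives unique, so that the solver's normal
    -- forms can be compared by refl.
    cancel : ℕ → ℕ → ℤ′
    cancel (suc a) (suc b) = cancel a b
    cancel zero    b       = zero , b
    cancel (suc a) zero    = suc a , zero

    ℤ′-rawRing : RawRing 0ℓ 0ℓ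
    ℤ′-rawRing = record
      { Carrier = ℤ′
      ; _≈_ = _≡_
      ; _+_ = λ { (a , b) (c , d) → cancel (a ℕ.+ c) (b ℕ.+ d) }
      ; _*_ = λ { (a , b) (c , d) → cancel (a ℕ.* c ℕ.+ b ℕ.* d) (a ℕ.* d ℕ.+ b ℕ.* c) }
      ; -_ = λ { (a , b) → b , a }
      ; 0# = 0 , 0
      ; 1# = 1 , 0
      }

    -- The optimised multiple makes the values at (0 , 0) and (1 , 0) equal to
    -- 0# and 1# definitionally.
    ⟦_⟧ : ℤ′ → ℝ
    ⟦ a , zero ⟧  = a ×′ 1#
    ⟦ a , suc b ⟧ = a ×′ 1# - suc b ×′ 1#

    ⟦⟧-difference : ∀ a b → ⟦ a , b ⟧ ≈ fromℕ a - fromℕ b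
    ⟦⟧-difference a zero = begin
      a ×′ 1#         ≈⟨ ×ᵤ≈× a 1# ⟨
      fromℕ a         ≈⟨ +-identityʳ _ ⟨
      fromℕ a + 0#    ≈⟨ +-congˡ -0#≈0# ⟨
      fromℕ a - 0#    ∎
    ⟦⟧-difference a (suc b) =
      +-cong (sym (×ᵤ≈× a 1#)) (-‿cong (sym (×ᵤ≈× (suc b) 1#)))

    cancel-correct : ∀ a b → ⟦ cancel a b ⟧ ≈ fromℕ a - fromℕ b
    cancel-correct zero    b       = ⟦⟧-difference zero b
    cancel-correct (suc a) zero    = ⟦⟧-difference (suc a) zero
    cancel-correct (suc a) (suc b) = begin
      ⟦ cancel a b ⟧                          ≈⟨ cancel-correct a b ⟩
      fromℕ a - fromℕ b                       ≈⟨ +-identityˡ _ ⟨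
      0# + (fromℕ a - fromℕ b)                ≈⟨ +-congʳ (-‿inverseʳ 1#) ⟨
      (1# - 1#) + (fromℕ a - fromℕ b)         ≈⟨ interchange _ _ _ _ ⟩
      (1# + fromℕ a) + (- 1# + - fromℕ b)     ≈⟨ +-congˡ (⁻¹-∙-comm _ _) ⟩
      fromℕ (suc a) - fromℕ (suc b)           ∎

    +-difference : ∀ a b c d → (a + c) - (b + d) ≈ (a - b) + (c - d)
    +-difference a b c d = begin
      (a + c) - (b + d)       ≈⟨ +-congˡ (⁻¹-∙-comm b d) ⟨
      (a + c) + (- b + - d)   ≈⟨ interchange _ _ _ _ ⟩
      (a - b) + (c - d)       ∎

    *-difference : ∀ a b c d → (a * c + b * d) - (a * d + b * c) ≈ (a - b) * (c - d)
    *-difference a b c d = begin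
      (a * c + b * d) - (a * d + b * c)              ≈⟨ +-difference _ _ _ _ ⟩
      (a * c - a * d) + (b * d - b * c)              ≈⟨ +-cong
        (trans (+-congˡ (-‿distribʳ-* a d)) (sym (distribˡ a c (- d))))
        (trans (+-cong
            (trans (sym (-‿involutive _)) (trans (-‿cong (-‿distribʳ-* b d)) (-‿distribˡ-* b (- d))))
            (-‿distribˡ-* b c))
          (trans (+-comm _ _) (sym (distribˡ (- b) c (- d))))) ⟩
      a * (c - d) + - b * (c - d)                    ≈⟨ distribʳ _ _ _ ⟨
      (a - b) * (c - d)                              ∎

    -‿difference : ∀ a b → b - a ≈ - (a - b)
    -‿difference a b = begin
      b - a         ≈⟨ +-comm _ _ ⟩
      - a + b       ≈⟨ +-congˡ (-‿involutive b) ⟨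
      - a + - - b   ≈⟨ ⁻¹-∙-comm a (- b) ⟩
      - (a - b)     ∎

    -- Equality in `ℝ` does not compute, so the ring solver normalises with integer coefficients
    -- instead; this map interprets them in `ℝ`.
    morphism : ℤ′-rawRing -Raw-AlmostCommutative⟶ fromCommutativeRing commutativeRing
    morphism = record
      { ⟦_⟧ = ⟦_⟧
      ; +-homo = λ { (a , b) (c , d) → begin
          ⟦ cancel (a ℕ.+ c) (b ℕ.+ d) ⟧                   ≈⟨ cancel-correct (a ℕ.+ c) _ ⟩
          fromℕ (a ℕ.+ c) - fromℕ (b ℕ.+ d)                ≈⟨ -cong (×-homo-+ 1# a c) (×-homo-+ 1# b d) ⟩
          (fromℕ a + fromℕ c) - (fromℕ b + fromℕ d)        ≈⟨ +-difference _ _ _ _ ⟩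
          (fromℕ a - fromℕ b) + (fromℕ c - fromℕ d)        ≈⟨ +-cong (⟦⟧-difference a b) (⟦⟧-difference c d) ⟨
          ⟦ a , b ⟧ + ⟦ c , d ⟧                            ∎ }
      ; *-homo = λ { (a , b) (c , d) → begin
          ⟦ cancel (a ℕ.* c ℕ.+ b ℕ.* d) (a ℕ.* d ℕ.+ b ℕ.* c) ⟧
            ≈⟨ cancel-correct (a ℕ.* c ℕ.+ b ℕ.* d) _ ⟩
          fromℕ (a ℕ.* c ℕ.+ b ℕ.* d) - fromℕ (a ℕ.* d ℕ.+ b ℕ.* c)
            ≈⟨ -cong (fromℕ-dot a b c d) (fromℕ-dot a b d c) ⟩
          (fromℕ a * fromℕ c + fromℕ b * fromℕ d) - (fromℕ a * fromℕ d + fromℕ b * fromℕ c)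
            ≈⟨ *-difference _ _ _ _ ⟩
          (fromℕ a - fromℕ b) * (fromℕ c - fromℕ d)
            ≈⟨ *-cong (⟦⟧-difference a b) (⟦⟧-difference c d) ⟨
          ⟦ a , b ⟧ * ⟦ c , d ⟧ ∎ }
      ; -‿homo = λ { (a , b) → begin
          ⟦ b , a ⟧                ≈⟨ ⟦⟧-difference b a ⟩
          fromℕ b - fromℕ a        ≈⟨ -‿difference _ _ ⟩
          - (fromℕ a - fromℕ b)    ≈⟨ -‿cong (⟦⟧-difference a b) ⟨
          - ⟦ a , b ⟧              ∎ }
      ; 0-homo = refl
      ; 1-homo = refl
      }
      where
      -cong : ∀ {a b c d} → a ≈ c → b ≈ d → a - b ≈ c - d
      -cong p q = +-cong p (-‿cong q)

      fromℕ-dot : ∀ a b c d → fromℕ (a ℕ.* c ℕ.+ b ℕ.* d) ≈ fromℕ a * fromℕ c + fromℕ b * fromℕ d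
      fromℕ-dot a b c d = trans (×-homo-+ 1# (a ℕ.* c) (b ℕ.* d)) (+-cong (×1-homo-* a c) (×1-homo-* b d))

    _≟_ : ∀ i j → Maybe (⟦ i ⟧ ≈ ⟦ j ⟧)
    (a , b) ≟ (c , d) with a ℕ.≟ c | b ℕ.≟ d
    ... | yes ≡.refl | yes ≡.refl = just refl
    ... | _          | _          = nothing

  open RingSolver IntegerCoefficients.ℤ′-rawRing (fromCommutativeRing commutativeRing)
    IntegerCoefficients.morphism IntegerCoefficients._≟_ public
    using (Polynomial; con; solve; _:+_; _:*_; _:-_; :-_; _:=_)

  :0 :1 : ∀ {n} → Polynomial n
  :0 = con (0 , 0)
  :1 = con (1 , 0)

  -- Most inequalities below are proved by certificate: `z` is a sum of products of nonnegative
  -- factors, and the remaining identity is left to the ring solver.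
  ≤-by : ∀ {x y z} → 0# ≤ z → x + z ≈ y → x ≤ y
  ≤-by {x} {y} {z} 0≤z x+z≈y = ≤-trans (≤-reflexive (solve 1 (λ x → x := :0 :+ x) refl x))
    (≤-trans (+-monoˡ-≤ x 0≤z) (≤-reflexive (trans (+-comm z x) x+z≈y)))

  x≤y⇒0≤y-x : ∀ {x y} → x ≤ y → 0# ≤ y - x
  x≤y⇒0≤y-x {x} {y} x≤y =
    ≤-trans (≤-reflexive (sym (-‿inverseʳ x))) (+-monoˡ-≤ (- x) x≤y)

  0≤-resp-≈ : ∀ {x y} → x ≈ y → 0# ≤ x → 0# ≤ y
  0≤-resp-≈ x≈y 0≤x = ≤-trans 0≤x (≤-reflexive x≈y)

  infixr 6 _⊕_
  infixr 7 _⊗_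

  _⊕_ : ∀ {x y} → 0# ≤ x → 0# ≤ y → 0# ≤ x + y
  _⊕_ {x} {y} 0≤x 0≤y = ≤-trans 0≤x (≤-by 0≤y refl)

  _⊗_ : ∀ {x y} → 0# ≤ x → 0# ≤ y → 0# ≤ x * y
  _⊗_ = *-nonNeg

  +-mono-≤ : ∀ {a b c d} → a ≤ b → c ≤ d → a + c ≤ b + d
  +-mono-≤ {a} {b} {c} {d} a≤b c≤d = ≤-by (x≤y⇒0≤y-x a≤b ⊕ x≤y⇒0≤y-x c≤d)
    (solve 4 (λ a b c d → a :+ c :+ ((b :- a) :+ (d :- c)) := b :+ d) refl a b c d)

  *-monoˡ-≤-nonNeg : ∀ {a b} c → 0# ≤ c → a ≤ b → c * a ≤ c * b
  *-monoˡ-≤-nonNeg {a} {b} c 0≤c a≤b = ≤-by (0≤c ⊗ x≤y⇒0≤y-x a≤b)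
    (solve 3 (λ a b c → c :* a :+ c :* (b :- a) := c :* b) refl a b c)

  x≤0⇒0≤-x : ∀ {x} → x ≤ 0# → 0# ≤ - x
  x≤0⇒0≤-x {x} x≤0 = 0≤-resp-≈ (+-identityˡ _) (x≤y⇒0≤y-x x≤0)

  0≤x² : ∀ x → 0# ≤ x * x
  0≤x² x with total 0# x
  ... | inj₁ 0≤x = 0≤x ⊗ 0≤x
  ... | inj₂ x≤0 = 0≤-resp-≈ (solve 1 (λ x → (:- x) :* (:- x) := x :* x) refl x)
    (x≤0⇒0≤-x x≤0 ⊗ x≤0⇒0≤-x x≤0)

  0≤1 : 0# ≤ 1#
  0≤1 = 0≤-resp-≈ (*-identityˡ 1#) (0≤x² 1#)

  0≤fromℕ : ∀ n → 0# ≤ fromℕ n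
  0≤fromℕ zero    = ≤-refl
  0≤fromℕ (suc n) = 0≤1 ⊕ 0≤fromℕ n

  fromℕ-mono-≤ : ∀ {m n} → m ℕ.≤ n → fromℕ m ≤ fromℕ n
  fromℕ-mono-≤ {n = n} ℕ.z≤n = 0≤fromℕ n
  fromℕ-mono-≤ (ℕ.s≤s m≤n)   = +-mono-≤ ≤-refl (fromℕ-mono-≤ m≤n)

  0≤x^n : ∀ {x} n → 0# ≤ x → 0# ≤ x ^ n
  0≤x^n zero    0≤x = 0≤1
  0≤x^n (suc n) 0≤x = 0≤x ⊗ 0≤x^n n 0≤x

  -- The reciprocal y equals x y², a product of nonnegative factors.
  x*y≈1⇒0≤y : ∀ {x y} → 0# ≤ x → x * y ≈ 1# → 0# ≤ y
  x*y≈1⇒0≤y {x} {y} 0≤x xy≈1 = 0≤-resp-≈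
    (trans (solve 2 (λ x y → x :* (y :* y) := x :* y :* y) refl x y)
      (trans (*-congʳ xy≈1) (*-identityˡ y)))
    (0≤x ⊗ 0≤x² y)

  *-cancelˡ-nonNeg : ∀ {x y} → 0# ≤ x → ¬ x ≈ 0# → 0# ≤ x * y → 0# ≤ y
  *-cancelˡ-nonNeg {x} {y} 0≤x x≉0 0≤xy with z , xz≈1 ← inverse x x≉0 = 0≤-resp-≈
    (trans (solve 3 (λ x y z → z :* (x :* y) := x :* z :* y) refl x y z)
      (trans (*-congʳ xz≈1) (*-identityˡ y)))
    (x*y≈1⇒0≤y 0≤x xz≈1 ⊗ 0≤xy)

  -- If x had a reciprocal y, then 1 = x² y² would be at most 0.
  x²≤0⇒x≈0 : ∀ {x} → x * x ≤ 0# → x ≈ 0#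
  x²≤0⇒x≈0 {x} x²≤0 with em {x ≈ 0#}
  ... | yes x≈0 = x≈0
  ... | no  x≉0 with y , xy≈1 ← inverse x x≉0 = ⊥-elim (0≉1 (antisym 0≤1
    (≤-by (x≤0⇒0≤-x x²≤0 ⊗ 0≤x² y)
      (trans (+-congʳ (trans (sym (*-identityˡ 1#)) (*-cong (sym xy≈1) (sym xy≈1))))
        (solve 2 (λ x y → x :* y :* (x :* y) :+ (:- (x :* x)) :* (y :* y) := :0) refl x y)))))

  -- Let s be the supremum of the multiples of x. From (n+1)x ≤ s follows nx ≤ s - x, so s - x is
  -- again an upper bound and s ≤ s - x.
  archimedean : ∀ x b → (∀ n → fromℕ n * x ≤ b) → x ≤ 0#
  archimedean x b nx≤b = ≤-by (x≤y⇒0≤y-x (least (s - x) s-x-upper))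
    (solve 2 (λ x s → x :+ ((s :- x) :- s) := :0) refl x s)
    where
    Multiples : ℝ → Set
    Multiples r = ∃ λ n → r ≈ fromℕ n * x

    sup : ∃ (IsSupremum Multiples)
    sup = complete Multiples (0# * x , 0 , refl)
      (b , λ { r (n , r≈) → ≤-trans (≤-reflexive r≈) (nx≤b n) })

    s     = proj₁ sup
    upper = proj₁ (proj₂ sup)
    least = proj₂ (proj₂ sup)

    s-x-upper : UpperBound Multiples (s - x)
    s-x-upper r (n , r≈) = ≤-trans (≤-reflexive r≈)
      (≤-by (x≤y⇒0≤y-x (upper _ (suc n , refl)))
        (solve 3 (λ n x s → n :* x :+ (s :- (:1 :+ n) :* x) := s :- x) refl (fromℕ n) x s))

  ∃-multiple-≥ : ∀ {x} b → 0# ≤ x → ¬ x ≈ 0# → ∃ λ n → b ≤ fromℕ n * x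
  ∃-multiple-≥ {x} b 0≤x x≉0 with em {∃ λ n → b ≤ fromℕ n * x}
  ... | yes found = found
  ... | no  none  = ⊥-elim (x≉0 (antisym (archimedean x b below) 0≤x))
    where
    below : ∀ n → fromℕ n * x ≤ b
    below n with total (fromℕ n * x) b
    ... | inj₁ p = p
    ... | inj₂ p = ⊥-elim (none (n , p))

  0≤1/suc : ∀ n → 0# ≤ 1/suc n
  0≤1/suc n = x*y≈1⇒0≤y (0≤fromℕ (suc n)) (*-1/suc n)

  0≤1/! : ∀ n → 0# ≤ 1/ n !
  0≤1/! zero    = 0≤1
  0≤1/! (suc n) = 0≤1/! n ⊗ 0≤1/suc n

  -- The absolute value

  ∣x∣≈x : ∀ {x} → 0# ≤ x → ∣ x ∣ ≈ x
  ∣x∣≈x 0≤x = x≥y⇒x⊔y≈x (≤-by (0≤x ⊕ 0≤x) (solve 1 (λ x → :- x :+ (x :+ x) := x) refl _))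

  ∣x∣≈-x : ∀ {x} → x ≤ 0# → ∣ x ∣ ≈ - x
  ∣x∣≈-x {x} x≤0 = x≤y⇒x⊔y≈y (≤-by (0≤-x ⊕ 0≤-x) (solve 1 (λ x → x :+ (:- x :+ :- x) := :- x) refl _))
    where 0≤-x = x≤0⇒0≤-x x≤0

  0≤∣x∣ : ∀ x → 0# ≤ ∣ x ∣
  0≤∣x∣ x with total 0# x
  ... | inj₁ 0≤x = 0≤-resp-≈ (sym (∣x∣≈x 0≤x)) 0≤x
  ... | inj₂ x≤0 = 0≤-resp-≈ (sym (∣x∣≈-x x≤0)) (x≤0⇒0≤-x x≤0)

  ∣x∣²≈x² : ∀ x → ∣ x ∣ * ∣ x ∣ ≈ x * x
  ∣x∣²≈x² x with total 0# x
  ... | inj₁ 0≤x = *-cong (∣x∣≈x 0≤x) (∣x∣≈x 0≤x)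
  ... | inj₂ x≤0 = trans (*-cong (∣x∣≈-x x≤0) (∣x∣≈-x x≤0))
    (solve 1 (λ x → (:- x) :* (:- x) := x :* x) refl x)

  ∣∣-cong : ∀ {x y} → x ≈ y → ∣ x ∣ ≈ ∣ y ∣
  ∣∣-cong x≈y = ⊔-cong x≈y (-‿cong x≈y)

  ∣c*x∣≈c*∣x∣ : ∀ {c} → 0# ≤ c → ∀ x → ∣ c * x ∣ ≈ c * ∣ x ∣
  ∣c*x∣≈c*∣x∣ {c} 0≤c x with total 0# x
  ... | inj₁ 0≤x = trans (∣x∣≈x (0≤c ⊗ 0≤x)) (*-congˡ (sym (∣x∣≈x 0≤x)))
  ... | inj₂ x≤0 = trans (∣x∣≈-x (≤-by (0≤c ⊗ x≤0⇒0≤-x x≤0)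
      (solve 2 (λ c x → c :* x :+ c :* (:- x) := :0) refl c x)))
    (trans (solve 2 (λ c x → :- (c :* x) := c :* (:- x)) refl c x) (*-congˡ (sym (∣x∣≈-x x≤0))))

  x*sgn[x]≈∣x∣ : ∀ x → x * sgn x ≈ ∣ x ∣
  x*sgn[x]≈∣x∣ x with em {x ≈ 0#} | total 0# x
  ... | yes x≈0 | _        = trans (zeroʳ x)
    (trans (sym x≈0) (sym (∣x∣≈x (≤-reflexive (sym x≈0)))))
  ... | no  _   | inj₁ 0≤x = trans (*-identityʳ x) (sym (∣x∣≈x 0≤x))
  ... | no  _   | inj₂ x≤0 =
    trans (solve 1 (λ x → x :* (:- :1) := :- x) refl x) (sym (∣x∣≈-x x≤0))

  square-mono-≤ : ∀ {x y} → 0# ≤ x → x ≤ y → x * x ≤ y * y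
  square-mono-≤ {x} {y} 0≤x x≤y = ≤-by ((0≤x ⊕ ≤-trans 0≤x x≤y) ⊗ x≤y⇒0≤y-x x≤y)
    (solve 2 (λ x y → x :* x :+ (x :+ y) :* (y :- x) := y :* y) refl x y)

  -- Powers and the exponential series

  -- These are the first two terms of the binomial expansion. Multiplying the inductive bound by s +
  -- x produces the next one plus the nonnegative term (n+1) x² s^n, which is dropped.
  bernoulli : ∀ {s x} → 0# ≤ s → 0# ≤ x → ∀ n →
              s ^ suc n + fromℕ (suc n) * (x * s ^ n) ≤ (s + x) ^ suc n
  bernoulli {s} {x} 0≤s 0≤x zero = ≤-reflexive
    (solve 2 (λ s x → s :* :1 :+ (:1 :+ :0) :* (x :* :1) := (s :+ x) :* :1) refl s x)
  bernoulli {s} {x} 0≤s 0≤x (suc n) = ≤-trans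
    (≤-by (0≤fromℕ (suc n) ⊗ (0≤x ⊗ 0≤x) ⊗ 0≤x^n n 0≤s)
      (solve 4 (λ s x p n →
        s :* (s :* p) :+ (:1 :+ n) :* (x :* (s :* p)) :+ n :* ((x :* x) :* p) :=
        (s :+ x) :* (s :* p :+ n :* (x :* p)))
        refl s x (s ^ n) (fromℕ (suc n))))
    (*-monoˡ-≤-nonNeg (s + x) (0≤s ⊕ 0≤x) (bernoulli 0≤s 0≤x n))

  expPoly : ℕ → ℝ → ℝ
  expPoly zero    s = 0#
  expPoly (suc j) s = expPoly j s + s ^ j * 1/ j !

  expPoly-cong : ∀ j {s t} → s ≈ t → expPoly j s ≈ expPoly j t
  expPoly-cong zero    s≈t = refl
  expPoly-cong (suc j) s≈t = +-cong (expPoly-cong j s≈t) (*-congʳ (^-congˡ j s≈t))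

  1^n≈1 : ∀ n → 1# ^ n ≈ 1#
  1^n≈1 zero    = refl
  1^n≈1 (suc n) = trans (*-identityˡ _) (1^n≈1 n)

  expPoly-1 : ∀ j → expPoly j 1# ≈ expSum j
  expPoly-1 zero    = refl
  expPoly-1 (suc j) = +-cong (expPoly-1 j) (trans (*-congʳ (1^n≈1 j)) (*-identityˡ _))

  -- Bernoulli's inequality divided by (j+1)! compares the terms of degree j + 1: the summand x s^j
  -- / j! on the left comes from (j+1) x s^j. This replaces the functional equation of the
  -- exponential.
  expPoly-step : ∀ {s x} → 0# ≤ s → 0# ≤ x → ∀ j →
                 expPoly (suc j) s + x * expPoly j s ≤ expPoly (suc j) (s + x)
  expPoly-step {s} {x} 0≤s 0≤x zero = ≤-reflexive
    (solve 1 (λ x → :0 :+ :1 :* :1 :+ x :* :0 := :0 :+ :1 :* :1) refl x)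
  expPoly-step {s} {x} 0≤s 0≤x (suc j) = ≤-trans (≤-reflexive (begin
      E₁ + s ^ suc j * (t * i) + x * (E₀ + p * t)
        ≈⟨ solve 7 (λ E₁ E₀ q t i x p → E₁ :+ q :* (t :* i) :+ x :* (E₀ :+ p :* t) :=
             E₁ :+ x :* E₀ :+ (q :* (t :* i) :+ :1 :* (x :* p :* t)))
             refl E₁ E₀ (s ^ suc j) t i x p ⟩
      E₁ + x * E₀ + (s ^ suc j * (t * i) + 1# * (x * p * t))
        ≈⟨ +-congˡ (+-congˡ (*-congʳ (*-1/suc j))) ⟨
      E₁ + x * E₀ + (s ^ suc j * (t * i) + fromℕ (suc j) * i * (x * p * t))
        ≈⟨ solve 8 (λ E₁ E₀ q t i x p n →
             E₁ :+ x :* E₀ :+ (q :* (t :* i) :+ n :* i :* (x :* p :* t)) :=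
             E₁ :+ x :* E₀ :+ t :* i :* (q :+ n :* (x :* p)))
             refl E₁ E₀ (s ^ suc j) t i x p (fromℕ (suc j)) ⟩
      E₁ + x * E₀ + t * i * (s ^ suc j + fromℕ (suc j) * (x * p)) ∎))
    (+-mono-≤ (expPoly-step 0≤s 0≤x j)
      (≤-trans (*-monoˡ-≤-nonNeg (t * i) (0≤1/! (suc j)) (bernoulli 0≤s 0≤x j))
        (≤-reflexive (*-comm _ _))))
    where
    open SetoidReasoning setoid
    E₀ = expPoly j s
    E₁ = expPoly (suc j) s
    t  = 1/ j !
    i  = 1/suc j
    p  = s ^ j

  [1+x]^n≤expPoly : ∀ {x} → 0# ≤ x → ∀ n → (1# + x) ^ n ≤ expPoly (suc n) (fromℕ n * x)
  [1+x]^n≤expPoly {x} 0≤x zero = ≤-reflexive (solve 0 (:1 := :0 :+ :1 :* :1) refl)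
  [1+x]^n≤expPoly {x} 0≤x (suc n) = ≤-trans
    (*-monoˡ-≤-nonNeg (1# + x) (0≤1 ⊕ 0≤x) ([1+x]^n≤expPoly 0≤x n))
    (≤-trans
      -- Adding the next term of the series at s supplies the longer polynomial that `expPoly-step`
      -- expects.
      (≤-by (0≤x^n (suc n) 0≤s ⊗ 0≤1/! (suc n))
        (solve 3 (λ x E t → (:1 :+ x) :* E :+ t := E :+ t :+ x :* E) refl
          x (expPoly (suc n) s) _))
      (≤-trans (expPoly-step 0≤s 0≤x (suc n)) (≤-reflexive (expPoly-cong (suc (suc n))
        (solve 2 (λ n x → n :* x :+ x := (:1 :+ n) :* x) refl (fromℕ n) x)))))
    where
    s = fromℕ n * x
    0≤s = 0≤fromℕ n ⊗ 0≤x

  expSum≤e : ∀ n → expSum n ≤ e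
  expSum≤e n = proj₁ (proj₂ e-isSupremum) (expSum n) (n , refl)

  0≤e : 0# ≤ e
  0≤e = expSum≤e 0

  [1+x]^n≤e : ∀ {x} → 0# ≤ x → ∀ n → fromℕ n * x ≈ 1# → (1# + x) ^ n ≤ e
  [1+x]^n≤e 0≤x n nx≈1 = ≤-trans ([1+x]^n≤expPoly 0≤x n)
    (≤-trans (≤-reflexive (trans (expPoly-cong (suc n) nx≈1) (expPoly-1 (suc n)))) (expSum≤e (suc n)))

  -- The reciprocal of 1 - 1/(n+2) is 1 + 1/(n+1).
  1≤[1-1/n]^[n-1]*e : ∀ n → 1# ≤ (1# - 1/suc (suc n)) ^ suc n * e
  1≤[1-1/n]^[n-1]*e n = ≤-trans (≤-reflexive (begin
      1#                                ≈⟨ 1^n≈1 (suc n) ⟨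
      1# ^ suc n                        ≈⟨ ^-congˡ (suc n) product ⟨
      ((1# - z) * (1# + y)) ^ suc n     ≈⟨ ^-distrib-* (1# - z) (1# + y) (suc n) ⟩
      (1# - z) ^ suc n * (1# + y) ^ suc n ∎))
    (*-monoˡ-≤-nonNeg _ (0≤x^n (suc n) 0≤1-z) ([1+x]^n≤e (0≤1/suc n) (suc n) (*-1/suc n)))
    where
    open SetoidReasoning setoid
    y = 1/suc n
    z = 1/suc (suc n)
    m = fromℕ (suc n)

    0≤1-z : 0# ≤ 1# - z
    0≤1-z = 0≤-resp-≈
      (trans (solve 2 (λ m z → m :* z := (:1 :+ m) :* z :- z) refl m z) (+-congʳ (*-1/suc (suc n))))
      (0≤fromℕ (suc n) ⊗ 0≤1/suc (suc n))

    product : (1# - z) * (1# + y) ≈ 1#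
    product = begin
      (1# - z) * (1# + y)
        ≈⟨ solve 2 (λ y z → (:1 :- z) :* (:1 :+ y) := :1 :+ y :* :1 :- z :* :1 :- y :* z) refl y z ⟩
      -- The factors `1#` are kept so that (1 + m) z and m y can be put in their place, after which
      -- everything but 1 cancels.
      1# + y * 1# - z * 1# - y * z
        ≈⟨ +-congʳ (+-cong (+-congˡ (*-congˡ (*-1/suc (suc n)))) (-‿cong (*-congˡ (*-1/suc n)))) ⟨
      1# + y * ((1# + m) * z) - z * (m * y) - y * z
        ≈⟨ solve 3 (λ y z m → :1 :+ y :* ((:1 :+ m) :* z) :- z :* (m :* y) :- y :* z := :1) refl y z m ⟩
      1# ∎

-- Sums and maxima over finite lists.

module ListFolds (em : ExcludedMiddle 0ℓ) (ℛ : CompleteOrderedField) {A : Set} where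

  open Analysis em ℛ hiding (zero)
  open OrderedField em ℛ

  ∑ : (A → ℝ) → List A → ℝ
  ∑ h xs = foldr _+_ 0# (map h xs)

  ∑-cong : ∀ {h k} → (∀ y → h y ≈ k y) → ∀ xs → ∑ h xs ≈ ∑ k xs
  ∑-cong h≈k []       = refl
  ∑-cong h≈k (x ∷ xs) = +-cong (h≈k x) (∑-cong h≈k xs)

  ∑-linear : ∀ a b h k xs → ∑ (λ y → a * h y + b * k y) xs ≈ a * ∑ h xs + b * ∑ k xs
  ∑-linear a b h k []       = solve 2 (λ a b → :0 := a :* :0 :+ b :* :0) refl a b
  ∑-linear a b h k (x ∷ xs) = trans (+-congˡ (∑-linear a b h k xs))
    (solve 6 (λ a b h k H K → a :* h :+ b :* k :+ (a :* H :+ b :* K) := a :* (h :+ H) :+ b :* (k :+ K))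
      refl a b (h x) (k x) (∑ h xs) (∑ k xs))

  ∑-const : ∀ c xs → ∑ (λ _ → c) xs ≈ fromℕ (length xs) * c
  ∑-const c []       = sym (zeroˡ c)
  ∑-const c (x ∷ xs) = trans (+-congˡ (∑-const c xs))
    (solve 2 (λ c n → c :+ n :* c := (:1 :+ n) :* c) refl c (fromℕ (length xs)))

  ∑-mono-≤ : ∀ {h k} → (∀ y → h y ≤ k y) → ∀ xs → ∑ h xs ≤ ∑ k xs
  ∑-mono-≤ h≤k []       = ≤-refl
  ∑-mono-≤ h≤k (x ∷ xs) = +-mono-≤ (h≤k x) (∑-mono-≤ h≤k xs)

  module _ {h : A → ℝ} (0≤h : ∀ y → 0# ≤ h y) where

    0≤∑ : ∀ xs → 0# ≤ ∑ h xs
    0≤∑ []       = ≤-refl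
    0≤∑ (x ∷ xs) = 0≤h x ⊕ 0≤∑ xs

    term≤∑ : ∀ {y xs} → y ∈ xs → h y ≤ ∑ h xs
    term≤∑ {xs = _ ∷ xs} (here ≡.refl) = ≤-by (0≤∑ xs) refl
    term≤∑ {xs = x ∷ _}  (there y∈xs)  = ≤-trans (term≤∑ y∈xs) (≤-by (0≤h x) (+-comm _ _))

    -- Distinct elements occupy distinct positions. This serves to count both the incoming and the
    -- outgoing edge of a nonbacktracking walk.
    two-terms≤∑ : ∀ {y z xs} → y ≢ z → y ∈ xs → z ∈ xs → h y + h z ≤ ∑ h xs
    two-terms≤∑ y≢z (here ≡.refl) (here ≡.refl) = ⊥-elim (y≢z ≡.refl)
    two-terms≤∑ y≢z (here ≡.refl) (there z∈xs)  = +-mono-≤ ≤-refl (term≤∑ z∈xs)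
    two-terms≤∑ y≢z (there y∈xs)  (here ≡.refl) =
      ≤-trans (≤-reflexive (+-comm _ _)) (+-mono-≤ ≤-refl (term≤∑ y∈xs))
    two-terms≤∑ {xs = x ∷ _} y≢z (there y∈xs) (there z∈xs) =
      ≤-trans (two-terms≤∑ y≢z y∈xs z∈xs) (≤-by (0≤h x) (+-comm _ _))

  maximum : (A → ℝ) → List A → ℝ
  maximum h xs = foldr _⊔_ 0# (map h xs)

  0≤maximum : ∀ h xs → 0# ≤ maximum h xs
  0≤maximum h []       = ≤-refl
  0≤maximum h (x ∷ xs) = ≤-trans (0≤maximum h xs) (x≤y⊔x (h x) _)

  -- The first alternative accounts for the initial value 0 of the fold.
  maximum-attained : ∀ h xs → maximum h xs ≈ 0# ⊎ (∃ λ y → y ∈ xs × h y ≈ maximum h xs)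
  maximum-attained h []       = inj₁ refl
  maximum-attained h (x ∷ xs) with ⊔-sel (h x) (maximum h xs)
  ... | inj₁ ≈hx  = inj₂ (x , here ≡.refl , sym ≈hx)
  ... | inj₂ ≈max with maximum-attained h xs
  ...   | inj₁ max≈0          = inj₁ (trans ≈max max≈0)
  ...   | inj₂ (y , y∈ , hy≈) = inj₂ (y , there y∈ , trans hy≈ (sym ≈max))

  maximum-scale : ∀ {c h k} → 0# ≤ c → (∀ y → k y ≈ c * h y) →
                  ∀ xs → maximum k xs ≈ c * maximum h xs
  maximum-scale {c} 0≤c k≈ch []       = sym (zeroʳ c)
  maximum-scale {c} 0≤c k≈ch (x ∷ xs) = trans (⊔-cong (k≈ch x) (maximum-scale 0≤c k≈ch xs))
    (sym (mono-≤-distrib-⊔ *-congˡ (*-monoˡ-≤-nonNeg c 0≤c) _ _))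

-- The graph Laplacian and the energy of a function.

module Laplacian (em : ExcludedMiddle 0ℓ) (ℛ : CompleteOrderedField) (G : Graph) where

  open Analysis em ℛ hiding (zero)
  open OnGraph G
  open OrderedField em ℛ
  open ListFolds em ℛ

  Δ-cong : ∀ {h k} → (∀ y → h y ≈ k y) → ∀ x → Δ h x ≈ Δ k x
  Δ-cong h≈k x = ∑-cong (λ y → +-cong (h≈k y) (-‿cong (h≈k x))) (nbrs x)

  Δ-linear : ∀ a b h k x → Δ (λ y → a * h y + b * k y) x ≈ a * Δ h x + b * Δ k x
  Δ-linear a b h k x = trans
    (∑-cong (λ y → solve 6 (λ a b h k h′ k′ →
        a :* h :+ b :* k :- (a :* h′ :+ b :* k′) := a :* (h :- h′) :+ b :* (k :- k′))
        refl a b (h y) (k y) (h x) (k x)) (nbrs x))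
    (∑-linear a b _ _ (nbrs x))

  Δ-scale : ∀ a h x → Δ (λ y → a * h y) x ≈ a * Δ h x
  Δ-scale a h x = trans
    (∑-cong (λ y → solve 3 (λ a h h′ →
        a :* h :- a :* h′ := a :* (h :- h′) :+ :0 :* (h :- h′)) refl a (h y) (h x)) (nbrs x))
    (trans (∑-linear a 0# _ _ (nbrs x))
      (solve 2 (λ a d → a :* d :+ :0 :* d := a :* d) refl a (Δ h x)))

  ∑nbrs≈Δ+deg : ∀ h x → ∑ h (nbrs x) ≈ Δ h x + fromℕ (deg x) * h x
  ∑nbrs≈Δ+deg h x = begin
    ∑ h (nbrs x)
      ≈⟨ ∑-cong (λ y → solve 2 (λ h h′ → h := :1 :* (h :- h′) :+ :1 :* h′) refl (h y) (h x)) (nbrs x) ⟩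
    ∑ (λ y → 1# * (h y - h x) + 1# * h x) (nbrs x)
      ≈⟨ ∑-linear 1# 1# _ _ (nbrs x) ⟩
    1# * Δ h x + 1# * ∑ (λ _ → h x) (nbrs x)
      ≈⟨ +-cong (*-identityˡ _) (trans (*-identityˡ _) (∑-const (h x) (nbrs x))) ⟩
    Δ h x + fromℕ (deg x) * h x ∎
    where open SetoidReasoning setoid

  -- Twice the carré du champ of h.
  energy : (V → ℝ) → V → ℝ
  energy h x = ∑ (λ y → (h y - h x) * (h y - h x)) (nbrs x)

  0≤energy : ∀ h x → 0# ≤ energy h x
  0≤energy h x = 0≤∑ (λ y → 0≤x² (h y - h x)) (nbrs x)

  -- Sum the identity b² - a² = (b - a)² + 2a(b - a) over the neighbours.
  Δ-square : ∀ h x → Δ (λ y → h y * h y) x ≈ energy h x + (1# + 1#) * (h x * Δ h x)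
  Δ-square h x = trans
    (∑-cong (λ y → solve 2 (λ h h′ → h :* h :- h′ :* h′ :=
        :1 :* ((h :- h′) :* (h :- h′)) :+ (:1 :+ :1) :* h′ :* (h :- h′)) refl (h y) (h x)) (nbrs x))
    (trans (∑-linear 1# ((1# + 1#) * h x) _ _ (nbrs x))
      (solve 3 (λ q h d → :1 :* q :+ (:1 :+ :1) :* h :* d := q :+ (:1 :+ :1) :* (h :* d))
        refl (energy h x) (h x) (Δ h x)))

  -- A zero of a nonnegative function is a minimum. This treats the vertices with vanishing
  -- gradient, where the curvature bound cannot be applied to a normalised function.
  0≤Δ-at-zero : ∀ {h} → (∀ y → 0# ≤ h y) → ∀ {x} → h x ≈ 0# → 0# ≤ Δ h x
  0≤Δ-at-zero {h} 0≤h {x} hx≈0 =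
    0≤-resp-≈ (trans (∑nbrs≈Δ+deg h x) (trans (+-congˡ (trans (*-congˡ hx≈0) (zeroʳ _))) (+-identityʳ _)))
      (0≤∑ 0≤h (nbrs x))

  -- Bounded degree: heat comparison, the operator `Q` and energy along walks.

  module BoundedDegree (D : ℕ) (deg≤D : ∀ x → deg x ℕ.≤ D) where

    -- There are at most D differences, each bounded by the nonnegative number B - h(x).
    Δ-upper : ∀ {h B} → (∀ y → h y ≤ B) → ∀ x → Δ h x ≤ fromℕ D * (B - h x)
    Δ-upper {h} {B} h≤B x = ≤-trans
      (∑-mono-≤ (λ y → +-mono-≤ (h≤B y) ≤-refl) (nbrs x))
      (≤-trans (≤-reflexive (∑-const (B - h x) (nbrs x)))
        (≤-by (x≤y⇒0≤y-x (fromℕ-mono-≤ (deg≤D x)) ⊗ x≤y⇒0≤y-x (h≤B x))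
          (solve 3 (λ n D c → n :* c :+ (D :- n) :* c := D :* c)
            refl (fromℕ (deg x)) (fromℕ D) (B - h x))))

    -- The hypotheses make u(t) = e^{-μt}(U + tG) a subsolution of the heat equation,
    -- so u ≤ B.  The heat flow is discretised by the Euler steps h ↦ h + εΔh, which
    -- are monotone as long as εD ≤ 1.
    module Subsolution
      {U G : V → ℝ} {B μ : ℝ} (0≤μ : 0# ≤ μ)
      (0≤U : ∀ x → 0# ≤ U x) (U≤B : ∀ x → U x ≤ B) (0≤G : ∀ x → 0# ≤ G x)
      (ΔU : ∀ x → G x ≤ Δ U x + μ * U x) (ΔG : ∀ x → 0# ≤ Δ G x + μ * G x)
      where

      module EulerSteps {ε} (0≤ε : 0# ≤ ε) (εD≤1 : ε * fromℕ D ≤ 1#) (0≤b : 0# ≤ 1# - ε * μ) where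

        b = 1# - ε * μ

        -- For h = αU + βG, the left side is at most h + εΔh by the two differential inequalities,
        -- and h + εΔh ≤ h + εD(B - h) ≤ B because εD ≤ 1.
        euler-step : ∀ {α β} → 0# ≤ α → 0# ≤ β → (∀ x → α * U x + β * G x ≤ B) →
                     ∀ x → α * b * U x + (α * ε + β * b) * G x ≤ B
        euler-step {α} {β} 0≤α 0≤β h≤B x = ≤-by
          (x≤y⇒0≤y-x εD≤1 ⊗ x≤y⇒0≤y-x (h≤B x)
            ⊕ 0≤ε ⊗ x≤y⇒0≤y-x (≤-trans (≤-reflexive (sym (Δ-linear α β U G x))) (Δ-upper h≤B x))
            ⊕ (0≤α ⊗ 0≤ε) ⊗ x≤y⇒0≤y-x (ΔU x)
            ⊕ (0≤β ⊗ 0≤ε) ⊗ ΔG x)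
          (solve 10 (λ B u g u′ g′ D ε μ α β →
            let b = :1 :- ε :* μ; h = α :* u :+ β :* g in
            α :* b :* u :+ (α :* ε :+ β :* b) :* g
              :+ ((:1 :- ε :* D) :* (B :- h)
                :+ (ε :* (D :* (B :- h) :- (α :* u′ :+ β :* g′))
                :+ (α :* ε :* (u′ :+ μ :* u :- g)
                :+ β :* ε :* (g′ :+ μ :* g)))) := B)
            refl B (U x) (G x) (Δ U x) (Δ G x) (fromℕ D) ε μ α β)

        0≤b^n : ∀ n → 0# ≤ b ^ n
        0≤b^n n = 0≤x^n n 0≤b

        -- The coefficients (α, β) start at (1, 0), and each step maps them to (αb, αε + βb).
        iterated : ∀ n x → b ^ suc n * U x + fromℕ (suc n) * ε * b ^ n * G x ≤ B
        iterated zero x = ≤-trans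
          (≤-reflexive (solve 4 (λ b ε u g →
            b :* :1 :* u :+ (:1 :+ :0) :* ε :* :1 :* g :=
            :1 :* b :* u :+ (:1 :* ε :+ :0 :* b) :* g) refl b ε (U x) (G x)))
          (euler-step 0≤1 ≤-refl
            (λ y → ≤-trans (≤-reflexive (solve 2 (λ u g → :1 :* u :+ :0 :* g := u) refl (U y) (G y))) (U≤B y)) x)
        iterated (suc n) x = ≤-trans
          (≤-reflexive (solve 6 (λ b ε u g p n →
            b :* (b :* p) :* u :+ (:1 :+ n) :* ε :* (b :* p) :* g :=
            b :* p :* b :* u :+ (b :* p :* ε :+ n :* ε :* p :* b) :* g)
            refl b ε (U x) (G x) (b ^ n) (fromℕ (suc n))))
          (euler-step (0≤b^n (suc n)) ((0≤fromℕ (suc n) ⊗ 0≤ε) ⊗ 0≤b^n n) (iterated n) x)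

        b^n*G-bound : ∀ n x → fromℕ (suc n) * ε * b ^ n * G x ≤ B
        b^n*G-bound n x = ≤-trans (≤-by (0≤b^n (suc n) ⊗ 0≤U x) (+-comm _ _)) (iterated n x)

      G≤eμB-positive : ¬ μ ≈ 0# → ∀ x → G x ≤ e * (μ * B)
      G≤eμB-positive μ≉0 x
        with k , D≤kμ ← ∃-multiple-≥ (fromℕ D) 0≤μ μ≉0
        with μ⁻¹ , μμ⁻¹≈1 ← inverse μ μ≉0 = ≤-trans
          (≤-by (0≤G x ⊗ x≤y⇒0≤y-x (1≤[1-1/n]^[n-1]*e k))
            (solve 3 (λ g p e → g :+ g :* (p :* e :- :1) := e :* (p :* g)) refl (G x) (z ^ suc k) e))
          (*-monoˡ-≤-nonNeg e 0≤e (≤-trans (≤-reflexive z^n*G) (*-monoˡ-≤-nonNeg μ 0≤μ (b^n*G-bound (suc k) x))))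
        where
        n i ε z : ℝ
        n = fromℕ (suc (suc k))
        i = 1/suc (suc k)
        ε = i * μ⁻¹
        z = 1# - i

        0≤μ⁻¹ = x*y≈1⇒0≤y 0≤μ μμ⁻¹≈1
        0≤ε = 0≤1/suc (suc k) ⊗ 0≤μ⁻¹

        εμ≈i : ε * μ ≈ i
        εμ≈i = trans (solve 3 (λ i y μ → i :* y :* μ := i :* (μ :* y)) refl i μ⁻¹ μ)
          (trans (*-congˡ μμ⁻¹≈1) (*-identityʳ i))

        εD≤1 : ε * fromℕ D ≤ 1#
        εD≤1 = ≤-trans
          (*-monoˡ-≤-nonNeg ε 0≤ε (≤-trans D≤kμ
            (≤-by ((0≤1 ⊕ 0≤1) ⊗ 0≤μ)
              (solve 2 (λ k μ → k :* μ :+ (:1 :+ :1) :* μ := (:1 :+ (:1 :+ k)) :* μ) refl (fromℕ k) μ))))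
          (≤-reflexive (trans (solve 3 (λ ε n μ → ε :* (n :* μ) := n :* (ε :* μ)) refl ε n μ)
            (trans (*-congˡ εμ≈i) (*-1/suc (suc k)))))

        b≈z : 1# - ε * μ ≈ z
        b≈z = +-congˡ (-‿cong εμ≈i)

        0≤b : 0# ≤ 1# - ε * μ
        0≤b = 0≤-resp-≈ (trans
            (solve 2 (λ m i → m :* i := (:1 :+ m) :* i :- i) refl (fromℕ (suc k)) i)
            (trans (+-congʳ (*-1/suc (suc k))) (sym b≈z)))
          (0≤fromℕ (suc k) ⊗ 0≤1/suc (suc k))

        open EulerSteps 0≤ε εD≤1 0≤b using (b^n*G-bound)

        z^n*G : z ^ suc k * G x ≈ μ * (n * ε * (1# - ε * μ) ^ suc k * G x)
        z^n*G = trans (*-congʳ (^-congˡ (suc k) (sym b≈z))) (sym (trans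
          (solve 5 (λ μ n ε p g → μ :* (n :* ε :* p :* g) := n :* (ε :* μ) :* (p :* g)) refl μ n ε _ (G x))
          (trans (*-congʳ (trans (*-congˡ εμ≈i) (*-1/suc (suc k)))) (*-identityˡ _))))

      -- Without decay, U + tG stays below B for arbitrarily large times t, so the Archimedean
      -- property excludes a positive G.
      G≤0-zero : μ ≈ 0# → ∀ x → G x ≤ 0#
      G≤0-zero μ≈0 x = archimedean (G x) (fromℕ (suc D) * B) bound
        where
        -- The denominator D + 1 also covers D = 0.
        ε = 1/suc D
        0≤ε = 0≤1/suc D

        b≈1 : 1# - ε * μ ≈ 1#
        b≈1 = trans (+-congˡ (-‿cong (*-congˡ μ≈0))) (solve 1 (λ ε → :1 :- ε :* :0 := :1) refl ε)

        εD≤1 : ε * fromℕ D ≤ 1#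
        εD≤1 = ≤-by 0≤ε (trans
          (solve 2 (λ ε D → ε :* D :+ ε := (:1 :+ D) :* ε) refl ε (fromℕ D)) (*-1/suc D))

        open EulerSteps 0≤ε εD≤1 (0≤-resp-≈ (sym b≈1) 0≤1) using (b^n*G-bound)

        bound : ∀ n → fromℕ n * G x ≤ fromℕ (suc D) * B
        bound n = ≤-trans (≤-by (0≤G x) (solve 2 (λ n g → n :* g :+ g := (:1 :+ n) :* g) refl (fromℕ n) (G x)))
          (≤-trans (≤-reflexive (begin
              fromℕ (suc n) * G x                          ≈⟨ *-identityˡ _ ⟨
              1# * (fromℕ (suc n) * G x)
                ≈⟨ *-cong (*-1/suc D) (*-congʳ (trans (*-congˡ (trans (^-congˡ n b≈1) (1^n≈1 n))) (*-identityʳ _))) ⟨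
              fromℕ (suc D) * ε * (fromℕ (suc n) * (1# - ε * μ) ^ n * G x)
                ≈⟨ solve 5 (λ D ε n p g → D :* ε :* (n :* p :* g) := D :* (n :* ε :* p :* g))
                     refl (fromℕ (suc D)) ε (fromℕ (suc n)) _ (G x) ⟩
              fromℕ (suc D) * (fromℕ (suc n) * ε * (1# - ε * μ) ^ n * G x) ∎))
            (*-monoˡ-≤-nonNeg _ (0≤fromℕ (suc D)) (b^n*G-bound n x)))
          where open SetoidReasoning setoid

      G≤eμB : ∀ x → G x ≤ e * (μ * B)
      G≤eμB x with em {μ ≈ 0#}
      ... | no  μ≉0 = G≤eμB-positive μ≉0 x
      ... | yes μ≈0 = ≤-trans (G≤0-zero μ≈0 x) (≤-reflexive
        (sym (trans (*-congˡ (trans (*-congʳ μ≈0) (zeroˡ B))) (zeroʳ e))))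

    -- D times the transition operator of the lazy random walk.
    Q : (V → ℝ) → V → ℝ
    Q h x = fromℕ D * h x + Δ h x

    Q^ : ℕ → (V → ℝ) → V → ℝ
    Q^ zero    h = h
    Q^ (suc n) h = Q (Q^ n h)

    -- The difference of the two sides is (D - deg x) h(x).
    Q-∑nbrs : ∀ {h} → (∀ y → 0# ≤ h y) → ∀ x → ∑ h (nbrs x) ≤ Q h x
    Q-∑nbrs {h} 0≤h x = ≤-trans (≤-reflexive (∑nbrs≈Δ+deg h x))
      (≤-by (x≤y⇒0≤y-x (fromℕ-mono-≤ (deg≤D x)) ⊗ 0≤h x)
        (solve 4 (λ d n D h → d :+ n :* h :+ (D :- n) :* h := D :* h :+ d)
          refl (Δ h x) (fromℕ (deg x)) (fromℕ D) (h x)))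

    0≤Q^ : ∀ n {h} → (∀ y → 0# ≤ h y) → ∀ x → 0# ≤ Q^ n h x
    0≤Q^ zero    0≤h   = 0≤h
    0≤Q^ (suc n) 0≤h x = ≤-trans (0≤∑ (0≤Q^ n 0≤h) (nbrs x)) (Q-∑nbrs (0≤Q^ n 0≤h) x)

    Q^-upper : ∀ n {h B} → (∀ y → h y ≤ B) → ∀ x → Q^ n h x ≤ fromℕ D ^ n * B
    Q^-upper zero    {h} {B} h≤B x = ≤-trans (h≤B x) (≤-reflexive (sym (*-identityˡ B)))
    Q^-upper (suc n) {h} {B} h≤B x = ≤-trans
      (+-mono-≤ ≤-refl (Δ-upper (Q^-upper n h≤B) x))
      (≤-reflexive (solve 4 (λ D p B h → D :* h :+ D :* (p :* B :- h) := D :* p :* B)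
        refl (fromℕ D) (fromℕ D ^ n) B (Q^ n h x)))

    -- `Q` is a polynomial in `Δ`, hence commutes with Δ + μ.
    Q^-resolvent : ∀ {μ h k} → (∀ y → Δ h y + μ * h y ≈ k y) →
                   ∀ n x → Δ (Q^ n h) x + μ * Q^ n h x ≈ Q^ n k x
    Q^-resolvent h≈k zero = h≈k
    Q^-resolvent {μ} {h} {k} h≈k (suc n) x = begin
      Δ (Q u) x + μ * Q u x
        ≈⟨ +-congʳ (trans
             (Δ-cong (λ y → +-congˡ (sym (*-identityˡ _))) x) (Δ-linear (fromℕ D) 1# u (Δ u) x)) ⟩
      fromℕ D * Δ u x + 1# * Δ (Δ u) x + μ * Q u x
        ≈⟨ solve 5 (λ D μ u u′ u″ → D :* u′ :+ :1 :* u″ :+ μ :* (D :* u :+ u′) :=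
             D :* (u′ :+ μ :* u) :+ (:1 :* u″ :+ μ :* u′)) refl (fromℕ D) μ (u x) (Δ u x) (Δ (Δ u) x) ⟩
      fromℕ D * (Δ u x + μ * u x) + (1# * Δ (Δ u) x + μ * Δ u x)
        ≈⟨ +-congˡ (trans
             (sym (Δ-linear 1# μ (Δ u) u x)) (Δ-cong (λ y → +-congʳ (*-identityˡ _)) x)) ⟩
      fromℕ D * (Δ u x + μ * u x) + Δ (λ y → Δ u y + μ * u y) x
        ≈⟨ +-cong (*-congˡ (Q^-resolvent h≈k n x)) (Δ-cong (Q^-resolvent h≈k n) x) ⟩
      Q (Q^ n k) x ∎
      where
      open SetoidReasoning setoid
      u = Q^ n h

    -- Nonbacktracking walks and their energy.

    NonBacktracking : ∀ {x y n} → V → Walk x y n → Set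
    NonBacktracking         u []              = ⊤
    NonBacktracking {x = x} u (_∷_ {y = z} _ w) = u ≢ z × NonBacktracking x w

    -- Here `u` is the vertex visited just before `x`. An immediate return to `u` could be cut out,
    -- leaving a walk from `u` that is two steps shorter.
    shortest⇒nonBacktracking : ∀ {u x y n} → u ~ x → (w : Walk x y n) →
                               (∀ m → Walk u y m → suc n ℕ.≤ m) → NonBacktracking u w
    shortest⇒nonBacktracking u~x []        _        = tt
    shortest⇒nonBacktracking u~x (x~z ∷ w) shortest =
      (λ { ≡.refl → ℕ.1+n≰n (ℕ.≤-trans (ℕ.n≤1+n _) (shortest _ w)) }) ,
      shortest⇒nonBacktracking x~z w (λ m v → ℕ.s≤s⁻¹ (shortest (suc m) (u~x ∷ v)))

    module WalkEnergy (f : V → ℝ) where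

      infix 8 δ_⟶_
      δ_⟶_ : V → V → ℝ
      δ x ⟶ y = (f y - f x) * (f y - f x)

      walkEnergy : ∀ {x y n} → Walk x y n → ℝ
      walkEnergy []                          = 0#
      walkEnergy {x = x} (_∷_ {y = z} _ w) = δ x ⟶ z + walkEnergy w

      -- This is ∑ᵢ (d - dᵢ)² ≥ 0, where dᵢ are the increments of f along w.
      cross-term : ∀ {x y n} (w : Walk x y n) d →
                   (1# + 1#) * (d * (f y - f x)) ≤ fromℕ n * (d * d) + walkEnergy w
      cross-term {x = x} [] d = ≤-reflexive
        (solve 2 (λ d f → (:1 :+ :1) :* (d :* (f :- f)) := :0 :* (d :* d) :+ :0) refl d (f x))
      cross-term {x} {y} {suc n} (_∷_ {y = z} _ w) d = ≤-by
        (x≤y⇒0≤y-x (cross-term w d) ⊕ 0≤x² (d - (f z - f x)))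
        (solve 6 (λ d fx fy fz n E →
          (:1 :+ :1) :* (d :* (fy :- fx)) :+
            ((n :* (d :* d) :+ E :- (:1 :+ :1) :* (d :* (fy :- fz)))
              :+ (d :- (fz :- fx)) :* (d :- (fz :- fx))) :=
          (:1 :+ n) :* (d :* d) :+ ((fz :- fx) :* (fz :- fx) :+ E))
          refl d (f x) (f y) (f z) (fromℕ n) (walkEnergy w))

      -- With d the first increment and s the sum of the others, (d + s)² = d² + 2ds + s².
      -- `cross-term` bounds 2ds, and induction bounds s².
      cauchy-schwarz : ∀ {x y n} (w : Walk x y n) → δ x ⟶ y ≤ fromℕ n * walkEnergy w
      cauchy-schwarz {x = x} [] = ≤-reflexive
        (solve 1 (λ f → (f :- f) :* (f :- f) := :0 :* :0) refl (f x))
      cauchy-schwarz {x} {y} {suc n} (_∷_ {y = z} _ w) = ≤-by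
        (x≤y⇒0≤y-x (cross-term w (f z - f x)) ⊕ x≤y⇒0≤y-x (cauchy-schwarz w))
        (solve 5 (λ fx fy fz n E → let d = fz :- fx; s = fy :- fz in
          (fy :- fx) :* (fy :- fx) :+
            ((n :* (d :* d) :+ E :- (:1 :+ :1) :* (d :* s)) :+ (n :* E :- s :* s)) :=
          (:1 :+ n) :* (d :* d :+ E))
          refl (f x) (f y) (f z) (fromℕ n) (walkEnergy w))

      0≤walkEnergy : ∀ {x y n} (w : Walk x y n) → 0# ≤ walkEnergy w
      0≤walkEnergy []                        = ≤-refl
      0≤walkEnergy {x} (_∷_ {y = z} _ w) = 0≤x² (f z - f x) ⊕ 0≤walkEnergy w

      ∈nbrs : ∀ {x y} → x ~ y → y ∈ nbrs x
      ∈nbrs = Equivalence.from ∈-nbrs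

      0≤δ : ∀ x y → 0# ≤ δ x ⟶ y
      0≤δ x y = 0≤x² (f y - f x)

      δ-sym : ∀ x y → δ x ⟶ y ≈ δ y ⟶ x
      δ-sym x y = solve 2 (λ a b → (b :- a) :* (b :- a) := (a :- b) :* (a :- b)) refl (f x) (f y)

      Q^-energy : ℕ → V → ℝ
      Q^-energy n = Q^ n (energy f)

      0≤Q^-energy : ∀ n x → 0# ≤ Q^-energy n x
      0≤Q^-energy n = 0≤Q^ n (0≤energy f)

      step≤Q^-energy : ∀ n {x y} → x ~ y → Q^-energy n y ≤ Q^-energy (suc n) x
      step≤Q^-energy n x~y = ≤-trans (term≤∑ (0≤Q^-energy n) (∈nbrs x~y)) (Q-∑nbrs (0≤Q^-energy n) _)

      -- Walking back and forth along the edge uses up the n steps, and the energy at either end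
      -- contains the edge.
      edge≤Q^-energy : ∀ n {x y} → x ~ y → δ x ⟶ y ≤ Q^-energy n x
      edge≤Q^-energy zero    x~y = term≤∑ (0≤δ _) (∈nbrs x~y)
      edge≤Q^-energy (suc n) x~y = ≤-trans (≤-reflexive (δ-sym _ _))
        (≤-trans (edge≤Q^-energy n (~-sym x~y)) (step≤Q^-energy n x~y))

      -- The energy at a vertex sees both the incoming and the outgoing edge, so
      -- walks of length n already reach all edges of a walk of length n + 1, each
      -- of them exactly once; the incoming edge u ~ x makes the induction work.
      incoming+walk≤Q^-energy : ∀ n {u x y k} → x ~ u → (w : Walk x y k) → k ℕ.≤ suc n →
                                NonBacktracking u w → δ x ⟶ u + walkEnergy w ≤ Q^-energy n x
      incoming+walk≤Q^-energy n x~u [] _ _ =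
        ≤-trans (≤-reflexive (+-identityʳ _)) (edge≤Q^-energy n x~u)
      incoming+walk≤Q^-energy zero x~u (x~z ∷ []) (ℕ.s≤s ℕ.z≤n) (u≢z , _) =
        ≤-trans (≤-reflexive (+-congˡ (+-identityʳ _)))
          (two-terms≤∑ (0≤δ _) u≢z (∈nbrs x~u) (∈nbrs x~z))
      -- The edge to `u` is charged to the neighbour `u`. The edge to z becomes the incoming edge at
      -- z and is charged there with the rest of the walk. As `u` differs from z, these are two
      -- separate terms of the sum over neighbours.
      incoming+walk≤Q^-energy (suc n) x~u (x~z ∷ w) (ℕ.s≤s k≤1+n) (u≢z , nb) = ≤-trans
        (+-mono-≤
          (≤-trans (≤-reflexive (δ-sym _ _)) (edge≤Q^-energy n (~-sym x~u)))
          (≤-trans (+-mono-≤ (≤-reflexive (δ-sym _ _)) ≤-refl)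
            (incoming+walk≤Q^-energy n (~-sym x~z) w k≤1+n nb)))
        (≤-trans (two-terms≤∑ (0≤Q^-energy n) u≢z (∈nbrs x~u) (∈nbrs x~z)) (Q-∑nbrs (0≤Q^-energy n) _))

      -- At the second vertex of the walk its first edge is the incoming one, so the previous bound
      -- applies there; one more factor `Q` leads back to `x`.
      shortest≤Q^-energy : ∀ n {x y k} (w : Walk x y k) → (∀ m → Walk x y m → k ℕ.≤ m) →
                           k ℕ.≤ suc n → walkEnergy w ≤ Q^-energy n x
      shortest≤Q^-energy n       []         _        _             = 0≤Q^-energy n _
      shortest≤Q^-energy zero    (x~z ∷ []) _        (ℕ.s≤s ℕ.z≤n) =
        ≤-trans (≤-reflexive (+-identityʳ _)) (edge≤Q^-energy zero x~z)
      shortest≤Q^-energy (suc n) (x~z ∷ w)  shortest (ℕ.s≤s k≤1+n) = ≤-trans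
        (+-mono-≤ (≤-reflexive (δ-sym _ _)) ≤-refl)
        (≤-trans
          (incoming+walk≤Q^-energy n (~-sym x~z) w k≤1+n (shortest⇒nonBacktracking x~z w shortest))
          (step≤Q^-energy n x~z))

      difference²≤Q^-energy : ∀ n {x y} → d⟨ x , y ⟩≤ suc n →
                              δ x ⟶ y ≤ fromℕ (suc n) * Q^-energy n x
      difference²≤Q^-energy n {x} (k , (w , shortest) , k≤1+n) = ≤-trans (cauchy-schwarz w)
        (≤-trans
          (≤-by (x≤y⇒0≤y-x (fromℕ-mono-≤ k≤1+n) ⊗ 0≤walkEnergy w)
            (solve 3 (λ k R E → k :* E :+ (R :- k) :* E := R :* E) refl (fromℕ k) (fromℕ (suc n)) (walkEnergy w)))
          (*-monoˡ-≤-nonNeg _ (0≤fromℕ (suc n)) (shortest≤Q^-energy n w shortest k≤1+n)))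

-- The gradient and the curvature condition.

module Gradient (em : ExcludedMiddle 0ℓ) (ℛ : CompleteOrderedField) (G : Graph) where

  open Analysis em ℛ hiding (zero)
  open OnGraph G
  open OrderedField em ℛ
  open ListFolds em ℛ
  open Laplacian em ℛ G

  curvature-lower-bound : ∀ R x y → [ 0# ] ≤± K R x y → ∀ r → CurvatureValues R x y r → 0# ≤ r
  curvature-lower-bound R x y 0≤K r r∈
    with Extrema.[ 0≤r ] ← Extrema.≤±-trans _≤_ ≤-trans 0≤K
                             (proj₁ (proj₂ (infimum (CurvatureValues R x y))) r r∈) = 0≤r

  0≤∣∇∣ : ∀ R f x → 0# ≤ ∣∇ R ∣ f x
  0≤∣∇∣ R f x = 0≤maximum _ (ball R x)

  ∣∇∣-attained : ∀ R f x → ∃ λ y → y ∈ ball R x × ∣ f y - f x ∣ ≈ ∣∇ R ∣ f x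
  ∣∇∣-attained R f x with maximum-attained (λ y → ∣ f y - f x ∣) (ball R x)
  ... | inj₂ attained = attained
  -- A vanishing maximum is attained at x itself, which lies in the ball.
  ... | inj₁ ≈0       = x , walk⇒ball R [] ℕ.z≤n ,
    trans (∣∣-cong (-‿inverseʳ (f x))) (trans (∣x∣≈x ≤-refl) (sym ≈0))

  difference-scale : ∀ c a b → c * a - c * b ≈ c * (a - b)
  difference-scale = solve 3 (λ c a b → c :* a :- c :* b := c :* (a :- b)) refl

  ∣difference∣-scale : ∀ {c} → 0# ≤ c → ∀ a b → ∣ c * a - c * b ∣ ≈ c * ∣ a - b ∣
  ∣difference∣-scale {c} 0≤c a b =
    trans (∣∣-cong (difference-scale c a b)) (∣c*x∣≈c*∣x∣ 0≤c (a - b))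

  ∣∇∣-scale : ∀ R {c} → 0# ≤ c → ∀ f x → ∣∇ R ∣ (λ y → c * f y) x ≈ c * ∣∇ R ∣ f x
  ∣∇∣-scale R 0≤c f x = maximum-scale 0≤c (λ y → ∣difference∣-scale 0≤c (f y) (f x)) (ball R x)

  -- Differential inequalities for eigenfunctions.

  module Eigenfunction {lam : ℝ} {f : V → ℝ} (-Δf≈λf : ∀ x → - Δ f x ≈ lam * f x) where

    Δf≈-λf : ∀ x → Δ f x ≈ - (lam * f x)
    Δf≈-λf x = trans (solve 1 (λ d → d := :- (:- d)) refl (Δ f x)) (-‿cong (-Δf≈λf x))

    Δf² : ∀ x → Δ (λ y → f y * f y) x + (1# + 1#) * lam * (f x * f x) ≈ energy f x
    Δf² x = trans (+-congʳ (trans (Δ-square f x) (+-congˡ (*-congˡ (*-congˡ (Δf≈-λf x))))))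
      (solve 3 (λ q l f → q :+ (:1 :+ :1) :* (f :* (:- (l :* f))) :+ (:1 :+ :1) :* l :* (f :* f) := q)
        refl (energy f x) lam (f x))

    module _ (R : ℕ) (0≤K : ∀ x y → d⟨ x , y ⟩≤ R → [ 0# ] ≤± K R x y) where

      g : V → ℝ
      g = ∣∇ R ∣ f

      0≤Δg+λg : ∀ x → 0# ≤ Δ g x + lam * g x
      0≤Δg+λg x with em {g x ≈ 0#}
      ... | yes gx≈0 = 0≤-resp-≈
        (sym (trans (+-congˡ (trans (*-congˡ gx≈0) (zeroʳ lam))) (+-identityʳ _)))
        (0≤Δ-at-zero (0≤∣∇∣ R f) gx≈0)
      ... | no  gx≉0
        -- Scaling f by c = 1/g(x) makes the gradient at x equal to 1. The curvature value of cf at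
        -- (x, y) is then cΔg(x) + λ, and multiplying by g(x) gives the claim.
        with c , gc≈1 ← inverse (g x) gx≉0
        with y , y∈ , y-max ← ∣∇∣-attained R f x = 0≤-resp-≈ (begin
            g x * (Δ (∣∇ R ∣ f′) x - (Δ f′ y - Δ f′ x) * sgn (f′ y - f′ x))
              ≈⟨ *-congˡ (+-cong Δg′ (-‿cong sgn-term)) ⟩
            g x * (c * Δ g x - (- lam))
              ≈⟨ solve 4 (λ g c d l → g :* (c :* d :- (:- l)) := g :* c :* d :+ l :* g)
                   refl (g x) c (Δ g x) lam ⟩
            g x * c * Δ g x + lam * g x
              ≈⟨ +-congʳ (trans (*-congʳ gc≈1) (*-identityˡ _)) ⟩
            Δ g x + lam * g x ∎)
          (0≤∣∇∣ R f x ⊗ curvature-lower-bound R x y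
            (0≤K x y (Equivalence.to (∈-ball em R) y∈)) _ (f′ , ∇f′≈1 , trans difference≈1 (sym ∇f′≈1) , refl))
        where
        open SetoidReasoning setoid

        0≤c = x*y≈1⇒0≤y (0≤∣∇∣ R f x) gc≈1

        f′ : V → ℝ
        f′ z = c * f z

        cg≈1 : c * g x ≈ 1#
        cg≈1 = trans (*-comm c (g x)) gc≈1

        ∇f′≈1 : ∣∇ R ∣ f′ x ≈ 1#
        ∇f′≈1 = trans (∣∇∣-scale R 0≤c f x) cg≈1

        difference≈1 : ∣ f′ y - f′ x ∣ ≈ 1#
        difference≈1 = trans (∣difference∣-scale 0≤c (f y) (f x)) (trans (*-congˡ y-max) cg≈1)

        Δg′ : Δ (∣∇ R ∣ f′) x ≈ c * Δ g x
        Δg′ = trans (Δ-cong (∣∇∣-scale R 0≤c f) x) (Δ-scale c g x)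

        Δf′ : ∀ z → Δ f′ z ≈ - (lam * f′ z)
        Δf′ z = trans (Δ-scale c f z) (trans (*-congˡ (Δf≈-λf z))
          (solve 3 (λ c l f → c :* (:- (l :* f)) := :- (l :* (c :* f))) refl c lam (f z)))

        sgn-term : (Δ f′ y - Δ f′ x) * sgn (f′ y - f′ x) ≈ - lam
        sgn-term = begin
          (Δ f′ y - Δ f′ x) * sgn (f′ y - f′ x)
            ≈⟨ *-congʳ (+-cong (Δf′ y) (-‿cong (Δf′ x))) ⟩
          (- (lam * f′ y) - - (lam * f′ x)) * sgn (f′ y - f′ x)
            ≈⟨ solve 4 (λ l a b s → (:- (l :* a) :- (:- (l :* b))) :* s := :- (l :* ((a :- b) :* s)))
                 refl lam (f′ y) (f′ x) _ ⟩
          - (lam * ((f′ y - f′ x) * sgn (f′ y - f′ x)))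
            ≈⟨ -‿cong (*-congˡ (trans (x*sgn[x]≈∣x∣ _) difference≈1)) ⟩
          - (lam * 1#)
            ≈⟨ -‿cong (*-identityʳ lam) ⟩
          - lam ∎

      -- The expression equals the energy of g plus 2g(Δg + λg).
      0≤Δg²+2λg² : ∀ x → 0# ≤ Δ (λ y → g y * g y) x + (1# + 1#) * lam * (g x * g x)
      0≤Δg²+2λg² x = 0≤-resp-≈
        (trans (solve 4 (λ q g d l → q :+ (:1 :+ :1) :* (g :* (d :+ l :* g)) :=
            q :+ (:1 :+ :1) :* (g :* d) :+ (:1 :+ :1) :* l :* (g :* g))
            refl (energy g x) (g x) (Δ g x) lam)
          (+-congʳ (sym (Δ-square g x))))
        (0≤energy g x ⊕ (0≤1 ⊕ 0≤1) ⊗ 0≤∣∇∣ R f x ⊗ 0≤Δg+λg x)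

    module _ (D : ℕ) (deg≤D : ∀ x → deg x ℕ.≤ D)
             {M} (∣f∣≤M : ∀ x → ∣ f x ∣ ≤ M) where

      open BoundedDegree D deg≤D

      f²≤M² : ∀ x → f x * f x ≤ M * M
      f²≤M² x = ≤-trans (≤-reflexive (sym (∣x∣²≈x² (f x)))) (square-mono-≤ (0≤∣x∣ (f x)) (∣f∣≤M x))

      -- If λ < 0, then Δ(f²) ≥ a f² with a = -2λ > 0. The subsolution bound with μ = 0, U = f² and
      -- G = a f² gives a f² ≤ 0, so f vanishes.
      0≤λ : ¬ (∀ x → f x ≈ 0#) → 0# ≤ lam
      0≤λ f≉0 with total 0# lam | em {lam ≈ 0#}
      ... | inj₁ 0≤lam | _         = 0≤lam
      ... | inj₂ _     | yes lam≈0 = ≤-reflexive (sym lam≈0)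
      ... | inj₂ lam≤0 | no  lam≉0 = ⊥-elim (f≉0 (λ x → x²≤0⇒x≈0 (f²≤0 x)))
        where
        a = (1# + 1#) * - lam
        0≤a = (0≤1 ⊕ 0≤1) ⊗ x≤0⇒0≤-x lam≤0

        a*f² : V → ℝ
        a*f² y = a * (f y * f y)

        a*f²≤Δf² : ∀ x → a*f² x ≤ Δ (λ y → f y * f y) x
        a*f²≤Δf² x = ≤-by (0≤energy f x) (trans (+-congˡ (sym (Δf² x)))
          (solve 3 (λ l f d → (:1 :+ :1) :* (:- l) :* (f :* f) :+ (d :+ (:1 :+ :1) :* l :* (f :* f)) := d)
            refl lam (f x) _))

        x+0*y≈x : ∀ x y → x + 0# * y ≈ x
        x+0*y≈x = solve 2 (λ x y → x :+ :0 :* y := x) refl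

        open Subsolution {U = λ y → f y * f y} {G = a*f²} {μ = 0#} ≤-refl
          (λ x → 0≤x² (f x)) f²≤M² (λ x → 0≤a ⊗ 0≤x² (f x))
          (λ x → ≤-trans (a*f²≤Δf² x) (≤-reflexive (sym (x+0*y≈x _ _))))
          (λ x → 0≤-resp-≈ (trans (sym (Δ-scale a _ x)) (sym (x+0*y≈x _ _)))
            (0≤a ⊗ ≤-trans (0≤a ⊗ 0≤x² (f x)) (a*f²≤Δf² x)))

        f²≤0 : ∀ x → f x * f x ≤ 0#
        f²≤0 x = ≤-by
          -- From -2(-λ)f² ≥ 0, adding one copy of (-λ)f² ≥ 0 leaves (-λ)(-f²) ≥ 0, and -λ can be
          -- cancelled.
          (*-cancelˡ-nonNeg 0≤-lam -lam≉0 (0≤-resp-≈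
            (solve 4 (λ e l F B →
              e :* (:0 :* B) :- (:1 :+ :1) :* (:- l) :* F :+ (:- l) :* F := (:- l) :* (:- F))
              refl e lam (f x * f x) (M * M))
            (x≤y⇒0≤y-x (G≤eμB x) ⊕ 0≤-lam ⊗ 0≤x² (f x))))
          (-‿inverseʳ _)
          where
          0≤-lam = x≤0⇒0≤-x lam≤0

          -lam≉0 : ¬ - lam ≈ 0#
          -lam≉0 -lam≈0 = lam≉0 (trans (solve 1 (λ l → l := :0 :- (:- l)) refl lam)
            (trans (+-congˡ (-‿cong -lam≈0)) (-‿inverseʳ 0#)))

      g²-bound : ∀ n (0≤K : ∀ x y → d⟨ x , y ⟩≤ suc n → [ 0# ] ≤± K (suc n) x y) → 0# ≤ lam →
                 ∀ x → ∣∇ suc n ∣ f x * ∣∇ suc n ∣ f x ≤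
                       e * ((1# + 1#) * lam * (fromℕ (suc n) * (fromℕ D ^ n * (M * M))))
      g²-bound n 0≤K 0≤lam = G≤eμB
        where
        R = fromℕ (suc n)
        0≤R = 0≤fromℕ (suc n)
        μ = (1# + 1#) * lam

        U : V → ℝ
        U y = Q^ n (λ z → f z * f z) y

        open WalkEnergy f using (Q^-energy; difference²≤Q^-energy)

        g²≤energy : ∀ x → ∣∇ suc n ∣ f x * ∣∇ suc n ∣ f x ≤ R * Q^-energy n x
        g²≤energy x with y , y∈ , y-max ← ∣∇∣-attained (suc n) f x = ≤-trans
          (≤-reflexive (trans (*-cong (sym y-max) (sym y-max)) (∣x∣²≈x² _)))
          (difference²≤Q^-energy n (Equivalence.to (∈-ball em (suc n)) y∈))

        RU-resolvent : ∀ x → Δ (λ y → R * U y) x + μ * (R * U x) ≈ R * Q^-energy n x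
        RU-resolvent x = trans (+-congʳ (Δ-scale R U x))
          (trans (solve 4 (λ R d μ u → R :* d :+ μ :* (R :* u) := R :* (d :+ μ :* u)) refl R (Δ U x) μ (U x))
            (*-congˡ (Q^-resolvent Δf² n x)))

        open Subsolution {U = λ y → R * U y} {G = λ y → ∣∇ suc n ∣ f y * ∣∇ suc n ∣ f y}
          ((0≤1 ⊕ 0≤1) ⊗ 0≤lam)
          (λ x → 0≤R ⊗ 0≤Q^ n (λ y → 0≤x² (f y)) x)
          (λ x → *-monoˡ-≤-nonNeg R 0≤R (Q^-upper n f²≤M² x))
          (λ x → 0≤x² _)
          (λ x → ≤-trans (g²≤energy x) (≤-reflexive (sym (RU-resolvent x))))
          (0≤Δg²+2λg² (suc n) 0≤K)

-- The gradient estimate in terms of the supremum norm.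

mainTheorem8 : (em : ExcludedMiddle 0ℓ) (ℛ : CompleteOrderedField) (G : Graph) →
    let open Analysis em ℛ
        open OnGraph G
    in
    (Degmax : ℕ) → IsLargestDegree Degmax →
    (R : ℕ) → 1 ℕ.≤ R →
    (∀ x y → d⟨ x , y ⟩≤ R → [ 0# ] ≤± K R x y) →
    (lam : ℝ) (f : V → ℝ) (bounded : Bounded f) →
    ¬ (∀ x → f x ≈ 0#) →
    (∀ x → - Δ f x ≈ lam * f x) →
    ∀ x → ∣∇ R ∣ f x ^ 2 ≤ fromℕ 2 * e * fromℕ R * fromℕ Degmax ^ (R ℕ.∸ 1) * lam * ‖ f , bounded ‖∞ ^ 2
-- Since R ≥ 1, only R = n + 1 occurs, and R - 1 computes to n.
mainTheorem8 em ℛ G D (deg≤D , _) (suc n) _ 0≤K lam f bounded f≉0 -Δf≈λf x =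
  ≤-trans (≤-reflexive (solve 1 (λ g → g :* (g :* :1) := g :* g) refl _))
    (≤-trans (g²-bound D deg≤D ∣f∣≤M n 0≤K (0≤λ D deg≤D ∣f∣≤M f≉0) x)
      (≤-reflexive (solve 5 (λ e l R p M →
        e :* ((:1 :+ :1) :* l :* (R :* (p :* (M :* M)))) :=
        (:1 :+ (:1 :+ :0)) :* e :* R :* p :* l :* (M :* (M :* :1)))
        refl e lam (fromℕ (suc n)) (fromℕ D ^ n) ‖ f , bounded ‖∞)))
  where
  open Analysis em ℛ hiding (zero)
  open OnGraph G
  open OrderedField em ℛ
  open Gradient em ℛ G
  open Eigenfunction -Δf≈λf

  ∣f∣≤M : ∀ y → ∣ f y ∣ ≤ ‖ f , bounded ‖∞
  ∣f∣≤M y = proj₁ (proj₂ (supNorm-isSupremum f bounded)) _ (inj₂ (y , refl))
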